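{- Let $m\ge 1$ be an integer, let $\mathbf{A}$ be the deformed quon algebra acting on the vector space $\mathbf{V}$ with vacuum vector $|0\rangle$, and let $\mathbf{H}=\{a|0\rangle : a\in\mathbf{A}\}\subseteq\mathbf{V}$. Then $\mathbf{H}$ is a Hilbert space for the bilinear form $(.,.):\mathbf{H}\times\mathbf{H}\to\mathbb{R}(q)$ defined by $$\big(a|0\rangle,\, b|0\rangle\big) := \langle 0|\,a^{\dag}\, b\,|0\rangle \quad\text{with}\quad \langle 0|0\rangle=1,$$ and for $$-1<q<1\ \text{ if } m=1,\qquad\text{and}\qquad \frac{1}{1-m}<q<1\ \text{ if } m>1.$$
   Context: Notation: $\mathbb{N}^*=\{1,2,3,\dots\}$, $[m]=\{1,\dots,m\}$, and $\mathbb{R}(q)$ is the fraction field of the real polynomials in the variable $q$. For $k,l\in[m]$ put $\beta_{ -k,l}=0$ if $l-k\equiv m \pmod m$ and $\beta_{ -k,l}=1$ otherwise; $\delta_{i,j}$ is the Kronecker delta. The deformed quon algebra $\mathbf{A}$ is the free algebra $\mathbb{R}(q)\big[a_{i,k} : (i,k)\in\mathbb{N}^*\times[m]\big]$ subject to the anti-involution $\dag$ exchanging $a_{i,k}$ with $a_{i,k}^{\dag}$ (so the $a_{i,k}^{\dag}$ also belong to $\mathbf{A}$), and to the commutation relations $$a_{j,l}\,a_{i,k}^{\dag}=q\,a_{i,k}^{\dag}\,a_{j,l}+q^{\beta_{ -k,l}}\,\delta_{i,j}\qquad\text{for all }(i,k),(j,l)\in\mathbb{N}^*\times[m].$$ Fock-like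 representation: the generators of $\mathbf{A}$ are linear operators $a_{i,k},a_{i,k}^{\dag}:\mathbf{V}\to\mathbf{V}$ on an infinite dimensional real vector space $\mathbf{V}$ satisfying these commutation relations and the relations $a_{i,k}|0\rangle=0$ for all $(i,k)$, where $a_{i,k}^{\dag}$ is the adjoint of $a_{i,k}$ and $|0\rangle$ is a nonzero distinguished vector of $\mathbf{V}$. The expression $\langle 0|\,x\,|0\rangle$, for $x\in\mathbf{A}$, is the vacuum expectation of $x$; it is linear in $x$ and is computed from $\langle 0|0\rangle=1$, $a_{i,k}|0\rangle=0$ and $\langle 0|a_{i,k}^{\dag}=0$.
   Formalization: "Hilbert space" is proved as a space with a well-defined symmetric positive definite bilinear form, without completeness (H is never complete: Σ 2^{ -i} a†_{i,1}|0⟩ has no limit in H); q is a real number, so scalars and form values are real rather than in ℝ(q). -}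

module Defs where

open import Level using (Level; _⊔_; suc)
open import Algebra.Bundles using (CommutativeRing; Semiring)
open import Algebra.Core using (Op₁; Op₂)
open import Algebra.Apartness.Structures using (IsHeytingField)
open import Algebra.Module.Bundles using (Module)
open import Algebra.Module.Bundles.Raw using (RawModule)
import Algebra.Module.Morphism.ModuleMonomorphism as ModuleMonomorphism
open import Algebra.Module.Morphism.Structures
  using (IsModuleHomomorphism; IsModuleMonomorphism)
import Algebra.Definitions.RawMonoid as RawMonoidDefs
import Algebra.Definitions.RawSemiring as RawSemiringDefs
open import Data.Fin.Base using (Fin; toℕ)
open import Data.Integer.Base as ℤ using (+_)
open import Data.Integer.Divisibility.Signed using (_∣?_)
open import Data.Nat.Base as ℕ using (ℕ)
import Data.Nat.Properties as ℕₚ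
open import Data.Product.Base using (Σ; ∃; _×_; _,_; proj₁; proj₂)
open import Data.Sum.Base using (_⊎_; inj₁)
open import Data.Bool.Base using (if_then_else_)
open import Relation.Binary.Core using (Rel)
open import Relation.Binary.Structures using (IsStrictPartialOrder)
open import Relation.Binary.PropositionalEquality.Core using (_≡_)
open import Relation.Nullary.Decidable.Core using (does)
open import Relation.Nullary.Negation.Core using (¬_)

-- The real numbers, given axiomatically as an Archimedean, Cauchy complete
-- ordered field.  Classically these axioms determine ℝ up to isomorphism.
-- They are the constructive ones: no trichotomy is assumed, so that they
-- also hold of Cauchy reals; apartness x # y is "x < y or y < x", and its
-- cotransitivity, tightness and the inverses of elements apart from 0 come
-- from IsHeytingField.

record RealNumbers c ℓ₁ ℓ₂ : Set (suc (c ⊔ ℓ₁ ⊔ ℓ₂)) where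
  infix  8 -_
  infixl 7 _*_
  infixl 6 _+_
  infix  4 _≈_ _<_ _≤_ _#_
  field
    Carrier : Set c
    _≈_     : Rel Carrier ℓ₁
    _<_     : Rel Carrier ℓ₂
    _+_ _*_ : Op₂ Carrier
    -_      : Op₁ Carrier
    0# 1#   : Carrier

  _#_ : Rel Carrier ℓ₂
  x # y = x < y ⊎ y < x

  _≤_ : Rel Carrier ℓ₂
  x ≤ y = ¬ (y < x)

  field
    isHeytingField       : IsHeytingField _≈_ _#_ _+_ _*_ -_ 0# 1#
    isStrictPartialOrder : IsStrictPartialOrder _≈_ _<_
    0<1                  : 0# < 1#
    +-monoˡ-<            : ∀ {x y} z → x < y → (x + z) < (y + z)
    *-pos                : ∀ {x y} → 0# < x → 0# < y → 0# < (x * y)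

  open IsHeytingField isHeytingField public
    using (isCommutativeRing; #⇒invertible; invertible⇒#; #-cotrans; tight)
  open IsStrictPartialOrder isStrictPartialOrder public
    using (<-resp-≈; irrefl; asym) renaming (trans to <-trans)

  commutativeRing : CommutativeRing c ℓ₁
  commutativeRing = record { isCommutativeRing = isCommutativeRing }

  open CommutativeRing commutativeRing public
    hiding (Carrier; _≈_; _+_; _*_; -_; 0#; 1#; isCommutativeRing)
  open RawSemiringDefs (Semiring.rawSemiring semiring) public
    using (_^_) renaming (_×_ to _×ℕ_)

  fromℕ : ℕ → Carrier
  fromℕ n = n ×ℕ 1#

  _⟶_ : (ℕ → Carrier) → Carrier → Set (c ⊔ ℓ₂)
  s ⟶ l = ∀ ε → 0# < ε → ∃ λ N → ∀ n → N ℕ.≤ n →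
            ((s n - l) < ε) × ((l - s n) < ε)

  IsCauchy : (ℕ → Carrier) → Set (c ⊔ ℓ₂)
  IsCauchy s = ∀ ε → 0# < ε → ∃ λ N → ∀ n p → N ℕ.≤ n → N ℕ.≤ p →
                 (s n - s p) < ε

  field
    archimedean : ∀ x → ∃ λ n → x < fromℕ n
    complete    : ∀ s → IsCauchy s → ∃ λ l → s ⟶ l

module _ {c ℓ₁ ℓ₂} (ℝ : RealNumbers c ℓ₁ ℓ₂) where
  open RealNumbers ℝ

  0<fromℕ : ∀ n → 0# < fromℕ (ℕ.suc n)
  0<fromℕ ℕ.zero    = proj₁ <-resp-≈ (sym (+-identityʳ 1#)) 0<1
  0<fromℕ (ℕ.suc n) = <-trans
    (0<fromℕ n)
    (proj₂ <-resp-≈ (+-identityˡ _) (+-monoˡ-< (fromℕ (ℕ.suc n)) 0<1))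

  1<fromℕ : ∀ m → 1 ℕ.< m → 1# < fromℕ m
  1<fromℕ (ℕ.suc (ℕ.suc n)) _ =
    proj₁ <-resp-≈ (+-comm _ _)
      (proj₂ <-resp-≈ (+-identityˡ _) (+-monoˡ-< 1# (0<fromℕ n)))
  1<fromℕ (ℕ.suc ℕ.zero) (ℕ.s≤s ())

  -- The inverse of 1# - fromℕ m.
  1/[1-_] : (m : ℕ) → 1 ℕ.< m → Carrier
  1/[1- m ] 1<m = proj₁ (#⇒invertible (inj₁ (1<fromℕ m 1<m)))

  Admissible : ℕ → Carrier → Set ℓ₂
  Admissible m q = (m ≡ 1 → (- 1# < q) × (q < 1#))
                 × ((1<m : 1 ℕ.< m) → (1/[1- m ] 1<m < q) × (q < 1#))

  -- Symmetric positive definite bilinear form.  Metric completeness is not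
  -- part of it: the space H below, of finite combinations of states, is
  -- never complete.
  record IsInnerProduct {v ℓv} (M : Module commutativeRing v ℓv)
                        (⟪_,_⟫ : Module.Carrierᴹ M → Module.Carrierᴹ M → Carrier)
                        : Set (c ⊔ ℓ₁ ⊔ ℓ₂ ⊔ v ⊔ ℓv) where
    open Module M using (Carrierᴹ; _≈ᴹ_; _+ᴹ_; _*ₗ_; 0ᴹ)
    field
      cong      : ∀ {x x′ y y′} → x ≈ᴹ x′ → y ≈ᴹ y′ → ⟪ x , y ⟫ ≈ ⟪ x′ , y′ ⟫
      +-linearˡ : ∀ x y z → ⟪ x +ᴹ y , z ⟫ ≈ ⟪ x , z ⟫ + ⟪ y , z ⟫
      *-linearˡ : ∀ r x y → ⟪ r *ₗ x , y ⟫ ≈ r * ⟪ x , y ⟫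
      +-linearʳ : ∀ x y z → ⟪ x , y +ᴹ z ⟫ ≈ ⟪ x , y ⟫ + ⟪ x , z ⟫
      *-linearʳ : ∀ r x y → ⟪ x , r *ₗ y ⟫ ≈ r * ⟪ x , y ⟫
      symmetric : ∀ x y → ⟪ x , y ⟫ ≈ ⟪ y , x ⟫
      nonNeg    : ∀ x → 0# ≤ ⟪ x , x ⟫
      definite  : ∀ x → ⟪ x , x ⟫ ≈ 0# → x ≈ᴹ 0ᴹ

-- The index i ∈ ℕ* is represented by i - 1 : ℕ and k ∈ [m] by k - 1 : Fin m;
-- only equality of the former and differences of the latter are used.

β : (m : ℕ) → Fin m → Fin m → ℕ
β m k l =
  if does (+ m ∣? (((+ toℕ l) ℤ.- (+ toℕ k)) ℤ.- + m)) then 0 else 1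

module _ {c ℓ₁ ℓ₂} (ℝ : RealNumbers c ℓ₁ ℓ₂) where
  open RealNumbers ℝ

  δ : ℕ → ℕ → Carrier
  δ i j = if does (i ℕₚ.≟ j) then 1# else 0#

-- The scalars ℝ(q) are taken at a real number q, so 𝐀 is a real algebra.

module QuonAlgebra {c ℓ₁ ℓ₂} (ℝ : RealNumbers c ℓ₁ ℓ₂)
                   (m : ℕ) (q : RealNumbers.Carrier ℝ) where
  open RealNumbers ℝ

  infixl 7 _*ᴬ_
  infixl 6 _+ᴬ_
  infix  4 _≈ᴬ_

  -- 𝐀 is the set of noncommutative polynomial expressions in the
  -- generators, taken up to _≈ᴬ_, which is generated by the laws of
  -- associative unital algebras and the commutation relations.
  data 𝐀 : Set c where
    const     : Carrier → 𝐀
    a a†      : ℕ → Fin m → 𝐀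
    _+ᴬ_ _*ᴬ_ : 𝐀 → 𝐀 → 𝐀

  data _≈ᴬ_ : Rel 𝐀 (c ⊔ ℓ₁) where
    reflᴬ  : ∀ {x} → x ≈ᴬ x
    symᴬ   : ∀ {x y} → x ≈ᴬ y → y ≈ᴬ x
    transᴬ : ∀ {x y z} → x ≈ᴬ y → y ≈ᴬ z → x ≈ᴬ z
    +-congᴬ : ∀ {x x′ y y′} → x ≈ᴬ x′ → y ≈ᴬ y′ → x +ᴬ y ≈ᴬ x′ +ᴬ y′
    *-congᴬ : ∀ {x x′ y y′} → x ≈ᴬ x′ → y ≈ᴬ y′ → x *ᴬ y ≈ᴬ x′ *ᴬ y′

    const-cong : ∀ {r s} → r ≈ s → const r ≈ᴬ const s
    const-+    : ∀ r s → const (r + s) ≈ᴬ const r +ᴬ const s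
    const-*    : ∀ r s → const (r * s) ≈ᴬ const r *ᴬ const s
    const-comm : ∀ r x → const r *ᴬ x ≈ᴬ x *ᴬ const r

    +-assocᴬ     : ∀ x y z → (x +ᴬ y) +ᴬ z ≈ᴬ x +ᴬ (y +ᴬ z)
    +-commᴬ      : ∀ x y → x +ᴬ y ≈ᴬ y +ᴬ x
    +-identityˡᴬ : ∀ x → const 0# +ᴬ x ≈ᴬ x
    *-assocᴬ     : ∀ x y z → (x *ᴬ y) *ᴬ z ≈ᴬ x *ᴬ (y *ᴬ z)
    *-identityˡᴬ : ∀ x → const 1# *ᴬ x ≈ᴬ x
    zeroˡᴬ       : ∀ x → const 0# *ᴬ x ≈ᴬ const 0#
    distribˡᴬ    : ∀ x y z → x *ᴬ (y +ᴬ z) ≈ᴬ (x *ᴬ y) +ᴬ (x *ᴬ z)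
    distribʳᴬ    : ∀ x y z → (y +ᴬ z) *ᴬ x ≈ᴬ (y *ᴬ x) +ᴬ (z *ᴬ x)

    commutation : ∀ i k j l →
      a j l *ᴬ a† i k ≈ᴬ const q *ᴬ (a† i k *ᴬ a j l)
                      +ᴬ const ((q ^ β m k l) * δ ℝ i j)

  infix 9 _†
  _† : 𝐀 → 𝐀
  const r †  = const r
  a i k †    = a† i k
  a† i k †   = a i k
  (x +ᴬ y) † = x † +ᴬ y †
  (x *ᴬ y) † = y † *ᴬ x †

  record VacuumExpectation : Set (c ⊔ ℓ₁) where
    field
      ⟨0∣_∣0⟩ : 𝐀 → Carrier
      cong    : ∀ {x y} → x ≈ᴬ y → ⟨0∣ x ∣0⟩ ≈ ⟨0∣ y ∣0⟩
      +-homo  : ∀ x y → ⟨0∣ x +ᴬ y ∣0⟩ ≈ ⟨0∣ x ∣0⟩ + ⟨0∣ y ∣0⟩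
      *-homo  : ∀ r x → ⟨0∣ const r *ᴬ x ∣0⟩ ≈ r * ⟨0∣ x ∣0⟩
      ⟨0∣0⟩≈1 : ⟨0∣ const 1# ∣0⟩ ≈ 1#
      a∣0⟩≈0  : ∀ x i k → ⟨0∣ x *ᴬ a i k ∣0⟩ ≈ 0#
      ⟨0∣a†≈0 : ∀ i k x → ⟨0∣ a† i k *ᴬ x ∣0⟩ ≈ 0#

  module _ {v ℓv} (V : Module commutativeRing v ℓv) where
    open Module V
    open RawMonoidDefs +ᴹ-rawMonoid using (sum)

    -- That a† is the adjoint of a is not a field: no form is given on V, and
    -- for the form defined below on H it always holds (form-adjoint).
    record FockRepresentation : Set (c ⊔ ℓ₁ ⊔ v ⊔ ℓv) where
      field
        infiniteDimensional : ∀ n (e : Fin n → Carrierᴹ) →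
          ¬ (∀ u → ∃ λ (r : Fin n → Carrier) → u ≈ᴹ sum (λ j → r j *ₗ e j))
        op op†   : ℕ → Fin m → Carrierᴹ → Carrierᴹ
        linear   : ∀ i k → IsModuleHomomorphism rawModule rawModule (op i k)
        linear†  : ∀ i k → IsModuleHomomorphism rawModule rawModule (op† i k)
        relation : ∀ i k j l u →
          op j l (op† i k u) ≈ᴹ q *ₗ op† i k (op j l u)
                             +ᴹ ((q ^ β m k l) * δ ℝ i j) *ₗ u
        ∣0⟩      : Carrierᴹ
        ∣0⟩≉0    : ¬ (∣0⟩ ≈ᴹ 0ᴹ)
        op∣0⟩≈0  : ∀ i k → op i k ∣0⟩ ≈ᴹ 0ᴹ

      infixr 7 _·_
      _·_ : 𝐀 → Carrierᴹ → Carrierᴹ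
      const r  · u = r *ₗ u
      a i k    · u = op i k u
      a† i k   · u = op† i k u
      (x +ᴬ y) · u = (x · u) +ᴹ (y · u)
      (x *ᴬ y) · u = x · (y · u)

      -- A vector of H is a vector of V together with some x ∈ 𝐀 producing it
      -- from the vacuum; the choice of x is ignored by the equality of H.
      Hᶜ : Set (c ⊔ v ⊔ ℓv)
      Hᶜ = Σ Carrierᴹ λ u → Σ 𝐀 λ x → u ≈ᴹ x · ∣0⟩

      rawH : RawModule Carrier (c ⊔ v ⊔ ℓv) ℓv
      rawH = record
        { Carrierᴹ = Hᶜ
        ; _≈ᴹ_     = λ u w → proj₁ u ≈ᴹ proj₁ w
        ; _+ᴹ_     = λ { (u , x , p) (w , y , r) →
                           u +ᴹ w , x +ᴬ y , +ᴹ-cong p r }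
        ; _*ₗ_     = λ { s (u , x , p) →
                           s *ₗ u , const s *ᴬ x , *ₗ-cong refl p }
        ; _*ᵣ_     = λ { (u , x , p) s →
                           u *ᵣ s , const s *ᴬ x
                         , ≈ᴹ-trans (≈ᴹ-sym (*ₗ-*ᵣ-coincident s u))
                                    (*ₗ-cong refl p) }
        ; 0ᴹ       = 0ᴹ , const 0# , ≈ᴹ-sym (*ₗ-zeroˡ ∣0⟩)
        ; -ᴹ_      = λ { (u , x , p) →
                           -ᴹ u , const (- 1#) *ᴬ x , neg u x p }
        }
        where
        open import Algebra.Module.Properties.LeftModule leftModule
          using (inverseʳ-uniqueᴹ)
        neg : ∀ u x → u ≈ᴹ x · ∣0⟩ → (-ᴹ u) ≈ᴹ (- 1#) *ₗ (x · ∣0⟩)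
        neg u x p = ≈ᴹ-sym (inverseʳ-uniqueᴹ u _
          (≈ᴹ-trans (+ᴹ-cong (≈ᴹ-trans p (≈ᴹ-sym (*ₗ-identityˡ _))) ≈ᴹ-refl)
          (≈ᴹ-trans (≈ᴹ-sym (*ₗ-distribʳ _ 1# (- 1#)))
          (≈ᴹ-trans (*ₗ-cong (-‿inverseʳ 1#) ≈ᴹ-refl)
                    (*ₗ-zeroˡ _)))))

      inclusion : IsModuleMonomorphism rawH rawModule proj₁
      inclusion = record
        { isModuleHomomorphism = record
          { isBimoduleHomomorphism = record
            { +ᴹ-isGroupHomomorphism = record
              { isMonoidHomomorphism = record
                { isMagmaHomomorphism = record
                  { isRelHomomorphism = record { cong = λ p → p }
                  ; homo = λ _ _ → ≈ᴹ-refl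
                  }
                ; ε-homo = ≈ᴹ-refl
                }
              ; ⁻¹-homo = λ _ → ≈ᴹ-refl
              }
            ; *ₗ-homo = λ _ _ → ≈ᴹ-refl
            ; *ᵣ-homo = λ _ _ → ≈ᴹ-refl
            }
          }
        ; injective = λ p → p
        }

      H : Module commutativeRing (c ⊔ v ⊔ ℓv) ℓv
      H = record
        { RawModule rawH
        ; isModule = ModuleMonomorphism.isModule inclusion
                       isCommutativeRing isModule
        }

      -- That the value depends only on the vectors is part of IsInnerProduct.
      form : VacuumExpectation → Hᶜ → Hᶜ → Carrier
      form E (_ , x , _) (_ , y , _) = ⟨0∣ x † *ᴬ y ∣0⟩
        where open VacuumExpectation E

      opᴴ op†ᴴ : ℕ → Fin m → Hᶜ → Hᶜ
      opᴴ i k (u , x , p) = op i k u , a i k *ᴬ x , ⟦⟧-cong p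
        where open IsModuleHomomorphism (linear i k)
      op†ᴴ i k (u , x , p) = op† i k u , a† i k *ᴬ x , ⟦⟧-cong p
        where open IsModuleHomomorphism (linear† i k)

      form-adjoint : ∀ E i k u w → form E (opᴴ i k u) w ≈ form E u (op†ᴴ i k w)
      form-adjoint E i k (_ , x , _) (_ , y , _) =
        VacuumExpectation.cong E (*-assocᴬ (x †) (a† i k) y)

{-# OPTIONS --safe #-}

-- Normal ordering turns the form into the Gram matrix
--   G(v , w) = Σ_σ q^{inv σ} Π B(vᵢ , w_{σ i}),   B((j,l) , (i,k)) = q^{β} δᵢⱼ,
-- on words.  B is positive definite, since on [m] it is (1 - q) I + q J, with
-- eigenvalues 1 - q and 1 + (m - 1) q.  For G one uses that the number of
-- inversions is a Hamming distance: expanding G along each letter of v in turn,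
-- where the other letters record on which side of the expanded one they were
-- and two letters whose records differ cost a factor q, gives
--   n Gₙ(v , w) = Σ_{k,l} B(v_k , w_l) G′ₙ₋₁(v without v_k , w without w_l),
-- where G′ is the Gram matrix over recording letters, with B ⊗ (1 q ; q 1) in
-- place of B.  So Gₙ is positive definite by induction on n, for all B at once.
--
-- That the form depends only on vectors of V follows from the linear
-- independence of the states a†_w|0⟩ in V: applying the adjoint words to a
-- vanishing combination, its part of top degree is seen to have norm 0.

module Submission where

open import Defs
open import Algebra.Bundles using (CommutativeMonoid)
open import Algebra.Module.Bundles using (Module)
open import Algebra.Module.Construct.TensorUnit using (⟨module⟩)
open import Algebra.Module.Morphism.Structures using (module IsModuleHomomorphism)
import Algebra.Properties.CommutativeSemigroup as CommutativeSemigroupProperties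
import Algebra.Properties.Ring as RingProperties
import Algebra.Solver.Ring.NaturalCoefficients.Default as NatCoeffSolver
open import Data.Bool.Base using (if_then_else_)
open import Data.Fin.Base using (Fin; zero; suc; toℕ)
import Data.Fin.Properties as Finₚ
open import Data.Integer.Base as ℤ using (+_)
import Data.Integer.Divisibility.Signed as ℤ∣
import Data.Integer.Properties as ℤₚ
open import Data.List.Base using (List; []; _∷_; _++_; [_]; map; length)
open import Data.List.Relation.Unary.All as All using (All; []; _∷_)
open import Data.Nat.Base as ℕ using (ℕ; zero; suc)
import Data.Nat.Divisibility as ℕ∣
import Data.Nat.Properties as ℕₚ
open import Data.Product.Base using (Σ; ∃; _×_; _,_; proj₁; proj₂)
open import Data.Sum.Base using (_⊎_; inj₁; inj₂; [_,_]′)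
open import Data.Vec.Base as Vec using (Vec; []; _∷_; toList; fromList)
import Data.Vec.Properties as Vecₚ
open import Function.Base using (_∘_; id)
open import Level using (_⊔_)
import Relation.Binary.Reasoning.Setoid as ≈-Reasoning
open import Relation.Binary.PropositionalEquality.Core as ≡ using (_≡_; _≢_)
open import Relation.Nullary.Decidable using (yes; no; dec-true; dec-false)
open import Relation.Nullary.Negation.Core using (¬_; contradiction)

-- Kernels live on arbitrary types, without decidable equality. Vectors are therefore unreduced
-- lists of terms, and definiteness cannot speak of their coefficients: it says that every map of
-- the index type into V evaluates the list to zero. This is also the form in which independence of
-- the states and definiteness on H are used. Positivity travels along linear maps that are
-- isometries up to a positive factor; injectivity is supplied by extending maps into V
-- (`pullback`).
--
-- The induction multiplies the smaller Gram matrix by B, so what is asked of B is that tensoring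
-- with it preserves positive definiteness (`TensorPositive`). For α I + β J this follows from
-- elimination. Letters of one mode (size m) and the two-valued records (size 2) both have this
-- shape with α = 1 - q and β = q, so q enters only through the positivity of 1 - q, 1 + (m - 1) q
-- and 1 + q.
--
-- The theorem speaks of every vacuum expectation: normal ordering uses only the axioms of an
-- expectation, so all of them agree with the one constructed here.

-- Order facts in a field without trichotomy.

module OrderedField {c ℓ₁ ℓ₂} (ℝ : RealNumbers c ℓ₁ ℓ₂) where
  open RealNumbers ℝ hiding (zero) renaming (_≤_ to _≼_)
  open RingProperties ring using (-‿distribˡ-*; -‿distribʳ-*; -‿involutive)

  <-cong : ∀ {x x′ y y′} → x ≈ x′ → y ≈ y′ → x < y → x′ < y′
  <-cong p r = proj₁ <-resp-≈ r ∘ proj₂ <-resp-≈ p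

  ≼-congʳ : ∀ {x x′} → x ≈ x′ → 0# ≼ x → 0# ≼ x′
  ≼-congʳ p 0≼x x′<0 = 0≼x (<-cong (sym p) refl x′<0)

  neg⇒pos : ∀ {x} → x < 0# → 0# < - x
  neg⇒pos {x} = <-cong (-‿inverseʳ x) (+-identityˡ _) ∘ +-monoˡ-< (- x)

  <⇒pos : ∀ {x y} → x < y → 0# < y - x
  <⇒pos {x} = <-cong (-‿inverseʳ x) refl ∘ +-monoˡ-< (- x)

  pos⇒neg : ∀ {x} → 0# < - x → x < 0#
  pos⇒neg {x} = <-cong (+-identityˡ _) (-‿inverseˡ x) ∘ +-monoˡ-< x

  pos-+ : ∀ {x y} → 0# < x → 0# < y → 0# < x + y
  pos-+ {x} {y} 0<x 0<y =
    <-trans 0<y (<-cong (+-identityˡ y) refl (+-monoˡ-< y 0<x))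

  pos*neg : ∀ {r x} → 0# < r → x < 0# → r * x < 0#
  pos*neg 0<r x<0 =
    pos⇒neg (<-cong refl (sym (-‿distribʳ-* _ _)) (*-pos 0<r (neg⇒pos x<0)))

  pos-square : ∀ {x} → x # 0# → 0# < x * x
  pos-square (inj₂ 0<x) = *-pos 0<x 0<x
  pos-square {x} (inj₁ x<0) = <-cong refl
    (trans (sym (-‿distribˡ-* x (- x)))
      (trans (-‿cong (sym (-‿distribʳ-* x x))) (-‿involutive _)))
    (*-pos (neg⇒pos x<0) (neg⇒pos x<0))

  -- All the order facts needed about ≼ and ≈ are negative, so trichotomy may
  -- be used for them.
  nonneg-cases : ∀ {x} → 0# ≼ x → ¬ ¬ (0# < x ⊎ x ≈ 0#)
  nonneg-cases {x} 0≼x k = k (inj₂ (proj₁ (tight x 0#) λ where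
    (inj₁ x<0) → 0≼x x<0
    (inj₂ 0<x) → k (inj₁ 0<x)))

  nonneg-+ : ∀ {x y} → 0# ≼ x → 0# ≼ y → 0# ≼ x + y
  nonneg-+ 0≼x 0≼y x+y<0 = nonneg-cases 0≼x λ where
    (inj₂ x≈0) → 0≼y (<-cong (trans (+-congʳ x≈0) (+-identityˡ _)) refl x+y<0)
    (inj₁ 0<x) → nonneg-cases 0≼y λ where
      (inj₁ 0<y) → asym x+y<0 (pos-+ 0<x 0<y)
      (inj₂ y≈0) →
        asym 0<x (<-cong (trans (+-congˡ y≈0) (+-identityʳ _)) refl x+y<0)

  nonneg-*⁻¹ : ∀ {r x} → 0# < r → 0# ≼ r * x → 0# ≼ x
  nonneg-*⁻¹ 0<r 0≼rx x<0 = 0≼rx (pos*neg 0<r x<0)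

  -- A number with negative square is not apart from 0, so by tightness it equals 0, and then its
  -- square is not negative.
  nonneg-square : ∀ x → 0# ≼ x * x
  nonneg-square x x²<0 = irrefl (trans (*-congʳ x≈0) (zeroˡ x)) x²<0
    where
    x≈0 : x ≈ 0#
    x≈0 = proj₁ (tight x 0#) λ x#0 → asym x²<0 (pos-square x#0)

  square≈0 : ∀ {x} → x * x ≈ 0# → x ≈ 0#
  square≈0 x²≈0 = proj₁ (tight _ 0#) λ x#0 → irrefl (sym x²≈0) (pos-square x#0)

  nonneg-+≈0 : ∀ {x y} → 0# ≼ x → 0# ≼ y → x + y ≈ 0# → x ≈ 0#
  nonneg-+≈0 {x} {y} 0≼x 0≼y x+y≈0 = proj₁ (tight x 0#) λ where
    (inj₁ x<0) → 0≼x x<0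
    (inj₂ 0<x) → 0≼y (<-cong (+-identityˡ y) x+y≈0 (+-monoˡ-< y 0<x))

  x-0≈x : ∀ x → x - 0# ≈ x
  x-0≈x x = trans (+-congˡ (trans (sym (+-identityˡ _)) (-‿inverseʳ 0#))) (+-identityʳ x)

  -- `#⇒invertible` inverts the difference r - 0, and invertibility of s only makes it apart from 0.
  -- A negative s would make r * s ≈ 1 negative.
  recip : ∀ {r} → 0# < r → ∃ λ s → r * s ≈ 1# × 0# < s
  recip {r} 0<r = s , r*s≈1 , s>0 (invertible⇒# s-invertible)
    where
    s = proj₁ (#⇒invertible (inj₂ 0<r))
    r*s≈1 : r * s ≈ 1#
    r*s≈1 = trans (*-congʳ (sym (x-0≈x _))) (proj₂ (proj₂ (#⇒invertible (inj₂ 0<r))))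
    s-invertible : ∃ λ t → t * (s - 0#) ≈ 1# × (s - 0#) * t ≈ 1#
    s-invertible = r , trans (*-congˡ (x-0≈x _)) r*s≈1
                     , trans (*-comm _ _) (trans (*-congˡ (x-0≈x _)) r*s≈1)
    s>0 : s # 0# → 0# < s
    s>0 (inj₂ 0<s) = 0<s
    s>0 (inj₁ s<0) with () ← irrefl refl
      (<-trans 0<1 (<-cong r*s≈1 refl (pos*neg 0<r s<0)))

  pos-cancelˡ : ∀ {r x} → 0# < r → 0# < r * x → 0# < x
  pos-cancelˡ {r} {x} 0<r 0<rx with s , r*s≈1 , 0<s ← recip 0<r =
    <-cong refl
      (trans (sym (*-assoc s r x))
        (trans (*-congʳ (trans (*-comm s r) r*s≈1)) (*-identityˡ x)))
      (*-pos 0<s 0<rx)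

-- Formal linear combinations and their evaluation in modules.

module Combinations {c ℓ₁ ℓ₂} (ℝ : RealNumbers c ℓ₁ ℓ₂) where
  open RealNumbers ℝ

  -- Repeated entries are never collected; combinations are compared only through their evaluations.
  LC : Set → Set c
  LC X = List (Carrier × X)

  private variable
    A B X Y : Set

  scale : Carrier → (X → Y) → LC X → LC Y
  scale r f []            = []
  scale r f ((s , x) ∷ d) = (r * s , f x) ∷ scale r f d

  scale-All : ∀ {ℓ} {P : Y → Set ℓ} r (f : X → Y) {d : LC X} →
              All (P ∘ f ∘ proj₂) d → All (P ∘ proj₂) (scale r f d)
  scale-All r f []       = []
  scale-All r f (p ∷ ps) = p ∷ scale-All r f ps

  bind : LC X → (X → LC Y) → LC Y
  bind []            f = []
  bind ((r , x) ∷ d) f = scale r id (f x) ++ bind d f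

  lefts : (X → A ⊎ B) → LC X → LC A
  lefts f []            = []
  lefts f ((r , x) ∷ d) with f x
  ... | inj₁ a = (r , a) ∷ lefts f d
  ... | inj₂ _ = lefts f d

  rights : (X → A ⊎ B) → LC X → LC B
  rights f []            = []
  rights f ((r , x) ∷ d) with f x
  ... | inj₁ _ = rights f d
  ... | inj₂ b = (r , b) ∷ rights f d

  module Evaluation {v ℓv} (M : Module commutativeRing v ℓv) where
    open Module M
    open CommutativeSemigroupProperties
      (CommutativeMonoid.commutativeSemigroup +ᴹ-commutativeMonoid)
      using (interchange)

    eval : LC X → (X → Carrierᴹ) → Carrierᴹ
    eval []            φ = 0ᴹ
    eval ((r , x) ∷ d) φ = r *ₗ φ x +ᴹ eval d φ

    eval-cong : ∀ (d : LC X) {φ ψ} → (∀ x → φ x ≈ᴹ ψ x) → eval d φ ≈ᴹ eval d ψ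
    eval-cong []            p = ≈ᴹ-refl
    eval-cong ((r , x) ∷ d) p = +ᴹ-cong (*ₗ-cong refl (p x)) (eval-cong d p)

    eval-0 : ∀ (d : LC X) {φ} → (∀ x → φ x ≈ᴹ 0ᴹ) → eval d φ ≈ᴹ 0ᴹ
    eval-0 []            p = ≈ᴹ-refl
    eval-0 ((r , x) ∷ d) p = ≈ᴹ-trans
      (+ᴹ-cong (≈ᴹ-trans (*ₗ-cong refl (p x)) (*ₗ-zeroʳ r)) (eval-0 d p))
      (+ᴹ-identityˡ 0ᴹ)

    eval-+ : ∀ (d : LC X) φ ψ →
             eval d (λ x → φ x +ᴹ ψ x) ≈ᴹ eval d φ +ᴹ eval d ψ
    eval-+ []            φ ψ = ≈ᴹ-sym (+ᴹ-identityˡ 0ᴹ)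
    eval-+ ((r , x) ∷ d) φ ψ = ≈ᴹ-trans
      (+ᴹ-cong (*ₗ-distribˡ r (φ x) (ψ x)) (eval-+ d φ ψ))
      (interchange _ _ _ _)

    eval-*ₗ : ∀ r (d : LC X) φ → eval d (λ x → r *ₗ φ x) ≈ᴹ r *ₗ eval d φ
    eval-*ₗ r []            φ = ≈ᴹ-sym (*ₗ-zeroʳ r)
    eval-*ₗ r ((s , x) ∷ d) φ = ≈ᴹ-trans
      (+ᴹ-cong (*ₗ-comm s r (φ x)) (eval-*ₗ r d φ))
      (≈ᴹ-sym (*ₗ-distribˡ r _ _))

    eval-++ : ∀ (d e : LC X) φ → eval (d ++ e) φ ≈ᴹ eval d φ +ᴹ eval e φ
    eval-++ []            e φ = ≈ᴹ-sym (+ᴹ-identityˡ _)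
    eval-++ ((r , x) ∷ d) e φ = ≈ᴹ-trans
      (+ᴹ-cong ≈ᴹ-refl (eval-++ d e φ)) (≈ᴹ-sym (+ᴹ-assoc _ _ _))

    eval-scale : ∀ r (f : X → Y) d φ →
                 eval (scale r f d) φ ≈ᴹ r *ₗ eval d (φ ∘ f)
    eval-scale r f []            φ = ≈ᴹ-sym (*ₗ-zeroʳ r)
    eval-scale r f ((s , x) ∷ d) φ = ≈ᴹ-trans
      (+ᴹ-cong (*ₗ-assoc r s _) (eval-scale r f d φ))
      (≈ᴹ-sym (*ₗ-distribˡ r _ _))

    eval-map : ∀ (f : X → Y) d φ → eval (scale 1# f d) φ ≈ᴹ eval d (φ ∘ f)
    eval-map f d φ = ≈ᴹ-trans (eval-scale 1# f d φ) (*ₗ-identityˡ _)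

    eval-bind : ∀ d (f : X → LC Y) φ →
                eval (bind d f) φ ≈ᴹ eval d (λ x → eval (f x) φ)
    eval-bind []            f φ = ≈ᴹ-refl
    eval-bind ((r , x) ∷ d) f φ = ≈ᴹ-trans (eval-++ (scale r id (f x)) _ φ)
      (+ᴹ-cong (eval-scale r id (f x) φ) (eval-bind d f φ))

    eval-return : ∀ (x : X) φ → eval [ (1# , x) ] φ ≈ᴹ φ x
    eval-return x φ = ≈ᴹ-trans (+ᴹ-identityʳ _) (*ₗ-identityˡ _)

    eval-swap : ∀ (d : LC X) (e : LC Y) (φ : X → Y → Carrierᴹ) →
                eval d (λ x → eval e (φ x)) ≈ᴹ eval e (λ y → eval d (λ x → φ x y))
    eval-swap []            e φ = ≈ᴹ-sym (eval-0 e λ _ → ≈ᴹ-refl)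
    eval-swap ((r , x) ∷ d) e φ = ≈ᴹ-trans
      (+ᴹ-cong (≈ᴹ-sym (eval-*ₗ r e (φ x))) (eval-swap d e φ))
      (≈ᴹ-sym (eval-+ e _ _))

    eval-cong-All : ∀ (d : LC X) {φ ψ} →
                    All (λ (_ , x) → φ x ≈ᴹ ψ x) d → eval d φ ≈ᴹ eval d ψ
    eval-cong-All []            []       = ≈ᴹ-refl
    eval-cong-All ((r , x) ∷ d) (p ∷ ps) =
      +ᴹ-cong (*ₗ-cong refl p) (eval-cong-All d ps)

    eval-0-All : ∀ (d : LC X) {φ} → All (λ (_ , x) → φ x ≈ᴹ 0ᴹ) d →
                 eval d φ ≈ᴹ 0ᴹ
    eval-0-All d p = ≈ᴹ-trans (eval-cong-All d p) (eval-0 d (λ _ → ≈ᴹ-refl))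

    eval-split : (f : X → A ⊎ B) (ι : A → X) (κ : B → X) →
                 (∀ x → [ ι , κ ]′ (f x) ≡ x) → ∀ d φ →
                 eval d φ ≈ᴹ eval (lefts f d) (φ ∘ ι) +ᴹ eval (rights f d) (φ ∘ κ)
    eval-split f ι κ p []            φ = ≈ᴹ-sym (+ᴹ-identityˡ 0ᴹ)
    eval-split f ι κ p ((r , x) ∷ d) φ with f x | p x
    ... | inj₁ a | ≡.refl = ≈ᴹ-trans
      (+ᴹ-cong ≈ᴹ-refl (eval-split f ι κ p d φ)) (≈ᴹ-sym (+ᴹ-assoc _ _ _))
    ... | inj₂ b | ≡.refl = ≈ᴹ-trans
      (+ᴹ-cong ≈ᴹ-refl (eval-split f ι κ p d φ))
      (≈ᴹ-trans (≈ᴹ-sym (+ᴹ-assoc _ _ _))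
      (≈ᴹ-trans (+ᴹ-cong (+ᴹ-comm _ _) ≈ᴹ-refl) (+ᴹ-assoc _ _ _)))

  open Evaluation (⟨module⟩ {R = commutativeRing}) public

  module _ {v ℓv w ℓw} (M : Module commutativeRing v ℓv) (N : Module commutativeRing w ℓw)
           where
    private
      module M = Module M
      module N = Module N
      module EM = Evaluation M
      module EN = Evaluation N

    eval-linear : ∀ {f} → f M.0ᴹ N.≈ᴹ N.0ᴹ →
                  (∀ x y → f (x M.+ᴹ y) N.≈ᴹ f x N.+ᴹ f y) →
                  (∀ r x → f (r M.*ₗ x) N.≈ᴹ r N.*ₗ f x) →
                  ∀ (d : LC X) φ → f (EM.eval d φ) N.≈ᴹ EN.eval d (f ∘ φ)
    eval-linear 0-homo +-homo *-homo []            φ = 0-homo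
    eval-linear 0-homo +-homo *-homo ((r , x) ∷ d) φ = N.≈ᴹ-trans (+-homo _ _)
      (N.+ᴹ-cong (*-homo r (φ x)) (eval-linear 0-homo +-homo *-homo d φ))

  module _ {v ℓv} (M : Module commutativeRing v ℓv) where
    open Module M

    eval-*-vector : ∀ (d : LC X) (ψ : X → Carrier) u →
                    Evaluation.eval M d (λ x → ψ x *ₗ u) ≈ᴹ eval d ψ *ₗ u
    eval-*-vector d ψ u = ≈ᴹ-sym (eval-linear ⟨module⟩ M (*ₗ-zeroˡ u)
      (λ r s → *ₗ-distribʳ u r s) (λ r s → *ₗ-assoc r s u) d ψ)

  ⟪_⟫ : (X → X → Carrier) → LC X → LC X → Carrier
  ⟪ K ⟫ d e = eval d (λ x → eval e (K x))

  _⊗_ : (X → X → Carrier) → (Y → Y → Carrier) → X × Y → X × Y → Carrier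
  (B ⊗ K) (x , y) (x′ , y′) = B x x′ * K y y′

-- Positive definite kernels and ways to transport them.

module Positivity {c ℓ₁ ℓ₂ v ℓv} (ℝ : RealNumbers c ℓ₁ ℓ₂)
                  (V : Module (RealNumbers.commutativeRing ℝ) v ℓv) where
  open RealNumbers ℝ hiding (zero) renaming (_≤_ to _≼_)
  open OrderedField ℝ
  open Combinations ℝ
  open Module V
  open Evaluation V using () renaming
    ( eval to evalⱽ; eval-cong to evalⱽ-cong; eval-0 to evalⱽ-0
    ; eval-bind to evalⱽ-bind; eval-split to evalⱽ-split )
  open import Relation.Binary.Reasoning.Setoid setoid

  private variable
    A B X Y : Set

  -- Stated for a single `d`, because orthogonal decompositions split one combination at a time. The
  -- conclusion of `definite` expresses that `d` is zero, as far as maps into V can tell.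
  record DefiniteAt (K : X → X → Carrier) (d : LC X) : Set (c ⊔ ℓ₁ ⊔ ℓ₂ ⊔ v ⊔ ℓv) where
    field
      nonneg   : 0# ≼ ⟪ K ⟫ d d
      definite : ⟪ K ⟫ d d ≈ 0# → ∀ φ → evalⱽ d φ ≈ᴹ 0ᴹ
  open DefiniteAt public

  PositiveDefinite : (X → X → Carrier) → Set (c ⊔ ℓ₁ ⊔ ℓ₂ ⊔ v ⊔ ℓv)
  PositiveDefinite K = ∀ d → DefiniteAt K d

  -- Up to the factor r, the form of L on `d` is the form of K on the image of `d` under the linear
  -- extension of `f`. That extension is injective, since by `lift` every map on Y factors through
  -- it.
  pullback : {K : X → X → Carrier} {L : Y → Y → Carrier}
             (f : Y → LC X) {r : Carrier} → 0# < r →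
             (∀ y y′ → r * L y y′ ≈ ⟪ K ⟫ (f y) (f y′)) →
             (lift : (Y → Carrierᴹ) → X → Carrierᴹ) →
             (∀ φ y → evalⱽ (f y) (lift φ) ≈ᴹ φ y) →
             PositiveDefinite K → PositiveDefinite L
  pullback {K = K} {L} f {r} 0<r isometry lift lift-inv K-pd d = record
    { nonneg   = nonneg-*⁻¹ 0<r (≼-congʳ (sym rQ) (nonneg (K-pd (bind d f))))
    ; definite = λ Q≈0 φ → ≈ᴹ-trans (evalⱽ-cong d (≈ᴹ-sym ∘ lift-inv φ))
        (≈ᴹ-trans (≈ᴹ-sym (evalⱽ-bind d f (lift φ)))
          (definite (K-pd (bind d f))
            (trans (sym rQ) (trans (*-congˡ Q≈0) (zeroʳ r))) (lift φ)))
    }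
    where
    rQ : r * ⟪ L ⟫ d d ≈ ⟪ K ⟫ (bind d f) (bind d f)
    rQ = begin
      r * eval d (λ y → eval d (L y))
        ≈⟨ eval-*ₗ r d _ ⟨
      eval d (λ y → r * eval d (L y))
        ≈⟨ eval-cong d (λ y → trans (sym (eval-*ₗ r d _)) (eval-cong d (isometry y))) ⟩
      eval d (λ y → eval d (λ y′ → eval (f y) (λ x → eval (f y′) (K x))))
        ≈⟨ eval-cong d (λ y → eval-swap d (f y) _) ⟩
      eval d (λ y → eval (f y) (λ x → eval d (λ y′ → eval (f y′) (K x))))
        ≈⟨ eval-cong d (λ y → eval-cong (f y) (λ x → sym (eval-bind d f (K x)))) ⟩
      eval d (λ y → eval (f y) (λ x → eval (bind d f) (K x)))
        ≈⟨ eval-bind d f _ ⟨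
      eval (bind d f) (λ x → eval (bind d f) (K x)) ∎

  scaled : ∀ {K : X → X → Carrier} {s} → 0# < s → PositiveDefinite K →
           PositiveDefinite (λ x y → s * K x y)
  scaled {K = K} {s} 0<s K-pd with r , sr≈1 , 0<r ← recip 0<s =
    pullback (λ x → [ (1# , x) ]) 0<r
      (λ x y → begin
        r * (s * K x y)   ≈⟨ *-assoc r s _ ⟨
        (r * s) * K x y   ≈⟨ *-congʳ (trans (*-comm r s) sr≈1) ⟩
        1# * K x y        ≈⟨ *-identityˡ _ ⟩
        K x y             ≈⟨ eval-return y (K x) ⟨
        eval [ (1# , y) ] (K x) ≈⟨ eval-return x (λ x → eval [ (1# , y) ] (K x)) ⟨
        ⟪ K ⟫ [ (1# , x) ] [ (1# , y) ] ∎)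
      id (λ φ y → Evaluation.eval-return V y φ) K-pd

  reindex : {K : X → X → Carrier} {L : Y → Y → Carrier}
            (f : Y → X) (g : X → Y) → (∀ y → g (f y) ≡ y) →
            (∀ y y′ → L y y′ ≈ K (f y) (f y′)) →
            PositiveDefinite K → PositiveDefinite L
  reindex {K = K} f g gf p = pullback (λ y → [ (1# , f y) ]) 0<1
      (λ y y′ → trans (*-identityˡ _) (trans (p y y′)
        (sym (trans (eval-return (f y) (λ x → eval [ (1# , f y′) ] (K x)))
                    (eval-return (f y′) (K (f y)))))))
      (_∘ g) (λ φ y → ≈ᴹ-trans (Evaluation.eval-return V (f y) (φ ∘ g))
                               (≈ᴹ-reflexive (≡.cong φ (gf y))))

  pd-cong : {K L : X → X → Carrier} → (∀ x y → L x y ≈ K x y) →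
            PositiveDefinite K → PositiveDefinite L
  pd-cong = reindex id id (λ _ → ≡.refl)

  -- Orthogonal decomposition. The cross terms need to vanish only on the two parts of `d`: in
  -- `graded-sum` the second index type is all of Σ ℕ X, and only the remaining entries are
  -- orthogonal to degree N.
  block : {K : X → X → Carrier} (f : X → A ⊎ B) (ι : A → X) (κ : B → X) →
          (∀ x → [ ι , κ ]′ (f x) ≡ x) → ∀ d →
          let d₁ = lefts f d; d₂ = rights f d in
          eval d₁ (λ a → eval d₂ (λ b → K (ι a) (κ b))) ≈ 0# →
          eval d₂ (λ b → eval d₁ (λ a → K (κ b) (ι a))) ≈ 0# →
          DefiniteAt (λ x y → K (ι x) (ι y)) d₁ →
          DefiniteAt (λ x y → K (κ x) (κ y)) d₂ →
          DefiniteAt K d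
  block {K = K} f ι κ inv d 0₁₂ 0₂₁ pd₁ pd₂ = record
    { nonneg   = ≼-congʳ (sym Q≈) (nonneg-+ (nonneg pd₁) (nonneg pd₂))
    ; definite = λ Q≈0 φ →
        let Q₁+Q₂≈0 = trans (sym Q≈) Q≈0
            Q₁≈0 = nonneg-+≈0 (nonneg pd₁) (nonneg pd₂) Q₁+Q₂≈0
            Q₂≈0 = nonneg-+≈0 (nonneg pd₂) (nonneg pd₁) (trans (+-comm _ _) Q₁+Q₂≈0)
        in ≈ᴹ-trans (splitⱽ φ)
             (≈ᴹ-trans (+ᴹ-cong (definite pd₁ Q₁≈0 _) (definite pd₂ Q₂≈0 _))
                       (+ᴹ-identityˡ 0ᴹ))
    }
    where
    d₁ = lefts f d
    d₂ = rights f d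
    split  = eval-split f ι κ inv d
    splitⱽ = evalⱽ-split f ι κ inv d
    Q≈ : ⟪ K ⟫ d d ≈ ⟪ (λ x y → K (ι x) (ι y)) ⟫ d₁ d₁ + ⟪ (λ x y → K (κ x) (κ y)) ⟫ d₂ d₂
    Q≈ = begin
      eval d (λ x → eval d (K x))
        ≈⟨ split _ ⟩
      eval d₁ (λ a → eval d (K (ι a))) + eval d₂ (λ b → eval d (K (κ b)))
        ≈⟨ +-cong
             (trans (eval-cong d₁ (λ a → split (K (ι a)))) (eval-+ d₁ _ _))
             (trans (eval-cong d₂ (λ b → split (K (κ b)))) (eval-+ d₂ _ _)) ⟩
      (eval d₁ (λ a → eval d₁ (K (ι a) ∘ ι)) + eval d₁ (λ a → eval d₂ (K (ι a) ∘ κ))) +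
      (eval d₂ (λ b → eval d₁ (K (κ b) ∘ ι)) + eval d₂ (λ b → eval d₂ (K (κ b) ∘ κ)))
        ≈⟨ +-cong (trans (+-congˡ 0₁₂) (+-identityʳ _))
                  (trans (+-congʳ 0₂₁) (+-identityˡ _)) ⟩
      eval d₁ (λ a → eval d₁ (K (ι a) ∘ ι)) + eval d₂ (λ b → eval d₂ (K (κ b) ∘ κ)) ∎

  module _ {K : (A ⊎ B) → (A ⊎ B) → Carrier} where
    binary-sum : (∀ a b → K (inj₁ a) (inj₂ b) ≈ 0#) →
                 (∀ a b → K (inj₂ b) (inj₁ a) ≈ 0#) →
                 PositiveDefinite (λ x y → K (inj₁ x) (inj₁ y)) →
                 PositiveDefinite (λ x y → K (inj₂ x) (inj₂ y)) →
                 PositiveDefinite K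
    binary-sum K₁₂ K₂₁ pd₁ pd₂ d = block id inj₁ inj₂ same d
      (eval-0 (lefts id d) λ a → eval-0 (rights id d) λ b → K₁₂ a b)
      (eval-0 (rights id d) λ b → eval-0 (lefts id d) λ a → K₂₁ a b)
      (pd₁ _) (pd₂ _)
      where
      same : ∀ x → [ inj₁ , inj₂ ]′ x ≡ x
      same (inj₁ _) = ≡.refl
      same (inj₂ _) = ≡.refl

  module _ {X : ℕ → Set} where
    component : ∀ N → Σ ℕ X → X N ⊎ Σ ℕ X
    component N (n , x) with n ℕₚ.≟ N
    ... | yes ≡.refl = inj₁ x
    ... | no  _      = inj₂ (n , x)

    component-inv : ∀ N x → [ (N ,_) , id ]′ (component N x) ≡ x
    component-inv N (n , x) with n ℕₚ.≟ N
    ... | yes ≡.refl = ≡.refl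
    ... | no  _      = ≡.refl

    Below : ℕ → LC (Σ ℕ X) → Set c
    Below N = All λ e → proj₁ (proj₂ e) ℕ.< N

    rights-below : ∀ N d → Below (suc N) d → Below N (rights (component N) d)
    rights-below N []                  []       = []
    rights-below N ((r , (n , x)) ∷ d) (p ∷ ps) with n ℕₚ.≟ N
    ... | yes ≡.refl = rights-below N d ps
    ... | no  n≢N    = ℕₚ.≤∧≢⇒< (ℕₚ.≤-pred p) n≢N ∷ rights-below N d ps

    bound : ∀ d → ∃ λ N → Below N d
    bound []                  = 0 , []
    bound ((r , (n , x)) ∷ d) with N , p ← bound d =
      suc n ℕ.⊔ N , ℕₚ.m≤m⊔n (suc n) N ∷
                    All.map (λ q → ℕₚ.≤-trans q (ℕₚ.m≤n⊔m (suc n) N)) p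

    -- A combination meets only finitely many degrees, so the orthogonal components can be split off
    -- from the top one downwards.
    graded-sum : {K : Σ ℕ X → Σ ℕ X → Carrier} →
                 (∀ x y → proj₁ x ≢ proj₁ y → K x y ≈ 0#) →
                 (∀ n → PositiveDefinite (λ x y → K (n , x) (n , y))) →
                 PositiveDefinite K
    graded-sum {K} K≈0 K-pd d = go _ d (proj₂ (bound d))
      where
      go : ∀ N d → Below N d → DefiniteAt K d
      go zero [] [] = record
        { nonneg   = λ 0<0 → irrefl refl 0<0
        ; definite = λ _ _ → ≈ᴹ-refl }
      go (suc N) d p = block (component N) (N ,_) id (component-inv N) d
        (eval-0 (lefts (component N) d) λ x →
          eval-0-All (rights (component N) d)
            (All.map (λ q → K≈0 _ _ (ℕₚ.<⇒≢ q ∘ ≡.sym)) rest))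
        (eval-0-All (rights (component N) d)
          (All.map (λ q → eval-0 (lefts (component N) d) λ x → K≈0 _ _ (ℕₚ.<⇒≢ q)) rest))
        (K-pd N _) (go N _ rest)
        where rest = rights-below N d p

  -- Quantifying over the other factor makes the notion stable under ⊗.
  TensorPositive : (X → X → Carrier) → Set _
  TensorPositive B = ∀ {Y : Set} {K : Y → Y → Carrier} →
                     PositiveDefinite K → PositiveDefinite (B ⊗ K)

  ⊗-tensorPositive : {B : X → X → Carrier} {C : Y → Y → Carrier} →
                     TensorPositive B → TensorPositive C → TensorPositive (B ⊗ C)
  ⊗-tensorPositive B-tp C-tp K-pd = reindex
    (λ { ((x , y) , z) → x , (y , z) }) (λ { (x , (y , z)) → (x , y) , z })
    (λ _ → ≡.refl) (λ _ _ → *-assoc _ _ _) (B-tp (C-tp K-pd))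

-- The matrices α I + β J.

module Compound {c ℓ₁ ℓ₂} (ℝ : RealNumbers c ℓ₁ ℓ₂) where
  open RealNumbers ℝ hiding (zero)
  open OrderedField ℝ

  -- The matrix α I + β J, where every entry of J is 1.
  compound : Carrier → Carrier → ∀ {n} → Fin n → Fin n → Carrier
  compound α β zero    zero    = α + β
  compound α β zero    (suc _) = β
  compound α β (suc _) zero    = β
  compound α β (suc k) (suc l) = compound α β k l

  compound-≡ : ∀ α β {n} (k : Fin n) → compound α β k k ≈ α + β
  compound-≡ α β zero    = refl
  compound-≡ α β (suc k) = compound-≡ α β k

  compound-≢ : ∀ α β {n} {k l : Fin n} → k ≢ l → compound α β k l ≈ β
  compound-≢ α β {k = zero}  {zero}  k≢l = contradiction ≡.refl k≢l
  compound-≢ α β {k = zero}  {suc _} _   = refl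
  compound-≢ α β {k = suc _} {zero}  _   = refl
  compound-≢ α β {k = suc k} {suc l} k≢l = compound-≢ α β (k≢l ∘ ≡.cong suc)

  compound-+ : ∀ {α β β′ γ} → β ≈ β′ + γ → ∀ {n} (k l : Fin n) →
               compound α β k l ≈ compound α β′ k l + γ
  compound-+ p zero    zero    = trans (+-congˡ p) (sym (+-assoc _ _ _))
  compound-+ p zero    (suc _) = p
  compound-+ p (suc _) zero    = p
  compound-+ p (suc k) (suc l) = compound-+ p k l

  pos-+-fromℕ : ∀ n {x y} → 0# < x → 0# < y → 0# < x + fromℕ n * y
  pos-+-fromℕ zero    0<x 0<y =
    <-cong refl (sym (trans (+-congˡ (zeroˡ _)) (+-identityʳ _))) 0<x
  pos-+-fromℕ (suc n) 0<x 0<y = pos-+ 0<x (*-pos (0<fromℕ ℝ n) 0<y)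

module CompoundPositivity {c ℓ₁ ℓ₂ v ℓv} (ℝ : RealNumbers c ℓ₁ ℓ₂)
                          (V : Module (RealNumbers.commutativeRing ℝ) v ℓv) where
  open RealNumbers ℝ hiding (zero)
  open OrderedField ℝ
  open Combinations ℝ
  open Compound ℝ
  open Positivity ℝ V
  open Module V
  open Evaluation V using () renaming
    ( eval to evalⱽ; eval-return to evalⱽ-return )
  open RingProperties ring using (+-cancelʳ)
  open NatCoeffSolver commutativeSemiring using (solve; _:=_; _:+_; _:*_; con)
  open import Relation.Binary.Reasoning.Setoid setoid

  -- One step of the Cholesky decomposition: the first basis vector is split
  -- off, and what remains on its orthogonal complement is α I + β′ J.
  compound-tensorPositive : ∀ n {α β} → 0# < α → 0# < α + fromℕ n * β →
                            TensorPositive (compound α β {n})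
  compound-tensorPositive zero 0<α _ K-pd [] = record
    { nonneg   = irrefl refl
    ; definite = λ _ _ → ≈ᴹ-refl }
  compound-tensorPositive zero 0<α _ K-pd ((_ , () , _) ∷ _)
  compound-tensorPositive (suc n) {α} {β} 0<α 0<α+nβ {Y} {K} K-pd =
    pullback f 0<1 isometry lift lift-inv L-pd
    where
    N = fromℕ n

    -- The trace: n + 1 diagonal entries α + β against the eigenvalues, α + (n + 1) β once and α
    -- with multiplicity n.
    0<s : 0# < α + β
    0<s = pos-cancelˡ (0<fromℕ ℝ n) (<-cong refl
      (solve 3 (λ N α β → (α :+ (con 1 :+ N) :* β) :+ N :* α :=
                          (con 1 :+ N) :* (α :+ β)) refl N α β)
      (pos-+-fromℕ n 0<α+nβ 0<α))

    s  = α + β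
    t  = proj₁ (recip 0<s)
    -- g = β / (α + β) is the coefficient of the projection of any other basis vector onto the
    -- first; β′ = β - β² / (α + β) is the off-diagonal entry of the Schur complement.
    g  = β * t
    β′ = β - β * g

    s*g≈β : s * g ≈ β
    s*g≈β = begin
      s * (β * t) ≈⟨ solve 3 (λ s b t → s :* (b :* t) := b :* (s :* t)) refl s β t ⟩
      β * (s * t) ≈⟨ *-congˡ (proj₁ (proj₂ (recip 0<s))) ⟩
      β * 1#      ≈⟨ *-identityʳ β ⟩
      β           ∎

    β≈β′+βg : β ≈ β′ + β * g
    β≈β′+βg = sym (begin
      (β - β * g) + β * g     ≈⟨ +-assoc _ _ _ ⟩
      β + (- (β * g) + β * g) ≈⟨ +-congˡ (-‿inverseˡ _) ⟩
      β + 0#                  ≈⟨ +-identityʳ β ⟩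
      β                       ∎)

    s*β′≈αβ : s * β′ ≈ α * β
    s*β′≈αβ = +-cancelʳ (β * β) _ _ (begin
      s * β′ + β * β       ≈⟨ +-congˡ (*-congˡ s*g≈β) ⟨
      s * β′ + β * (s * g)
        ≈⟨ solve 4 (λ s b′ b g → s :* b′ :+ b :* (s :* g) := s :* (b′ :+ b :* g))
             refl s β′ β g ⟩
      s * (β′ + β * g)     ≈⟨ *-congˡ β≈β′+βg ⟨
      s * β                ≈⟨ distribʳ β α β ⟩
      α * β + β * β        ∎)

    -- Up to a power of α this is the factorization of the determinant into the pivot s and the
    -- determinant of the Schur complement.
    0<α+Nβ′ : 0# < α + N * β′
    0<α+Nβ′ = pos-cancelˡ 0<s (<-cong refl (begin
      α * (α + (1# + N) * β)
        ≈⟨ solve 3 (λ a b N → a :* (a :+ (con 1 :+ N) :* b) := (a :+ b) :* a :+ N :* (a :* b))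
             refl α β N ⟩
      s * α + N * (α * β)
        ≈⟨ +-congˡ (*-congˡ s*β′≈αβ) ⟨
      s * α + N * (s * β′)
        ≈⟨ solve 4 (λ s a N b′ → s :* a :+ N :* (s :* b′) := s :* (a :+ N :* b′)) refl s α N β′ ⟩
      s * (α + N * β′) ∎)
      (*-pos 0<α 0<α+nβ))

    L : Y ⊎ (Fin n × Y) → Y ⊎ (Fin n × Y) → Carrier
    L (inj₁ x) (inj₁ y) = s * K x y
    L (inj₁ _) (inj₂ _) = 0#
    L (inj₂ _) (inj₁ _) = 0#
    L (inj₂ x) (inj₂ y) = (compound α β′ ⊗ K) x y

    L-pd : PositiveDefinite L
    L-pd = binary-sum (λ _ _ → refl) (λ _ _ → refl) (scaled 0<s K-pd)
                      (compound-tensorPositive n 0<α 0<α+Nβ′ K-pd)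

    -- Each later basis vector is g times the first plus its component in the orthogonal complement.
    f : Fin (suc n) × Y → LC (Y ⊎ (Fin n × Y))
    f (zero  , x) = [ (1# , inj₁ x) ]
    f (suc k , x) = (g , inj₁ x) ∷ (1# , inj₂ (k , x)) ∷ []

    isometry : ∀ x y → 1# * (compound α β ⊗ K) x y ≈ ⟪ L ⟫ (f x) (f y)
    isometry (zero , x) (zero , y) =
      solve 1 (λ a → con 1 :* a := con 1 :* (con 1 :* a :+ con 0) :+ con 0) refl (s * K x y)
    isometry (zero , x) (suc l , y) = begin
      1# * (β * K x y)
        ≈⟨ *-congˡ (*-congʳ s*g≈β) ⟨
      1# * (s * g * K x y)
        ≈⟨ solve 3 (λ s g a → con 1 :* (s :* g :* a) :=
             con 1 :* (g :* (s :* a) :+ (con 1 :* con 0 :+ con 0)) :+ con 0) refl s g (K x y) ⟩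
      ⟪ L ⟫ (f (zero , x)) (f (suc l , y)) ∎
    isometry (suc k , x) (zero , y) = begin
      1# * (β * K x y)
        ≈⟨ *-congˡ (*-congʳ s*g≈β) ⟨
      1# * (s * g * K x y)
        ≈⟨ solve 3 (λ s g a → con 1 :* (s :* g :* a) :=
             g :* (con 1 :* (s :* a) :+ con 0) :+ (con 1 :* (con 1 :* con 0 :+ con 0) :+ con 0))
             refl s g (K x y) ⟩
      ⟪ L ⟫ (f (suc k , x)) (f (zero , y)) ∎
    isometry (suc k , x) (suc l , y) = begin
      1# * (compound α β k l * K x y)
        ≈⟨ *-congˡ (*-congʳ (trans (compound-+ β≈β′+βg k l) (+-congˡ (*-congʳ (sym s*g≈β))))) ⟩
      1# * ((compound α β′ k l + s * g * g) * K x y)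
        ≈⟨ solve 4 (λ s g b a → con 1 :* ((b :+ s :* g :* g) :* a) :=
             g :* (g :* (s :* a) :+ (con 1 :* con 0 :+ con 0)) :+
             (con 1 :* (g :* con 0 :+ (con 1 :* (b :* a) :+ con 0)) :+ con 0))
             refl s g (compound α β′ k l) (K x y) ⟩
      ⟪ L ⟫ (f (suc k , x)) (f (suc l , y)) ∎

    -- The triangular change of basis `f` is undone by subtracting g times the value at the first
    -- vector.
    lift : (Fin (suc n) × Y → Carrierᴹ) → Y ⊎ (Fin n × Y) → Carrierᴹ
    lift φ (inj₁ x)       = φ (zero , x)
    lift φ (inj₂ (k , x)) = φ (suc k , x) +ᴹ (- g) *ₗ φ (zero , x)

    lift-inv : ∀ φ x → evalⱽ (f x) (lift φ) ≈ᴹ φ x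
    lift-inv φ (zero  , x) = evalⱽ-return (inj₁ x) (lift φ)
    lift-inv φ (suc k , x) = M.begin
      g *ₗ u +ᴹ evalⱽ [ (1# , inj₂ (k , x)) ] (lift φ)
        M.≈⟨ +ᴹ-cong ≈ᴹ-refl (evalⱽ-return (inj₂ (k , x)) (lift φ)) ⟩
      g *ₗ u +ᴹ (w +ᴹ (- g) *ₗ u)   M.≈⟨ +ᴹ-cong ≈ᴹ-refl (+ᴹ-comm _ _) ⟩
      g *ₗ u +ᴹ ((- g) *ₗ u +ᴹ w)   M.≈⟨ +ᴹ-assoc _ _ _ ⟨
      (g *ₗ u +ᴹ (- g) *ₗ u) +ᴹ w   M.≈⟨ +ᴹ-cong (*ₗ-distribʳ u g (- g)) ≈ᴹ-refl ⟨
      (g - g) *ₗ u +ᴹ w             M.≈⟨ +ᴹ-cong (*ₗ-cong (-‿inverseʳ g) ≈ᴹ-refl) ≈ᴹ-refl ⟩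
      0# *ₗ u +ᴹ w                  M.≈⟨ +ᴹ-cong (*ₗ-zeroˡ u) ≈ᴹ-refl ⟩
      0ᴹ +ᴹ w                       M.≈⟨ +ᴹ-identityˡ w ⟩
      w                             M.∎
      where
      u = φ (zero , x)
      w = φ (suc k , x)
      module M = ≈-Reasoning ≈ᴹ-setoid

-- Expansions of the q-deformed Gram matrix.

pattern before = zero
pattern after  = suc zero

module QGram {c ℓ₁ ℓ₂} (ℝ : RealNumbers c ℓ₁ ℓ₂) (q : RealNumbers.Carrier ℝ) where
  open RealNumbers ℝ hiding (zero)
  open Combinations ℝ
  open Compound ℝ
  open NatCoeffSolver commutativeSemiring using (solve; _:=_; _:+_; _:*_)
  open import Relation.Binary.Reasoning.Setoid setoid

  private variable
    Y Z : Set

  -- Σₗ qˡ (wₗ , w without wₗ), counting from l = 0.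
  picks : List Y → LC (Y × List Y)
  picks []      = []
  picks (y ∷ w) = (1# , y , w) ∷ scale q (λ (z , u) → z , y ∷ u) (picks w)

  -- Σ_σ q^{inv σ} Πᵢ B vᵢ w_{σ i}, or 0 if the lengths differ.
  gram : (Y → Y → Carrier) → List Y → List Y → Carrier
  gram B []      []      = 1#
  gram B []      (_ ∷ _) = 0#
  gram B (s ∷ v) w       = eval (picks w) (λ (z , u) → B s z * gram B v u)

  -- Σₗ (wₗ , w without wₗ), where the remaining letters remember on which
  -- side of wₗ they were.
  marks : List Y → LC (Y × List (Y × Fin 2))
  marks []      = []
  marks (y ∷ w) = (1# , y , map (_, after) w) ∷
                  scale 1# (λ (z , r) → z , (y , before) ∷ r) (marks w)

  -- The entries of `marks` as a relation, so that the expansion along one letter can be proved by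
  -- induction on its position.
  data Mark {Y : Set} : List Y → Y → List (Y × Fin 2) → Set where
    here  : ∀ {y w} → Mark (y ∷ w) y (map (_, after) w)
    there : ∀ {y w z r} → Mark w z r → Mark (y ∷ w) z ((y , before) ∷ r)

  -- The matrix (1 q ; q 1), written as a `compound` so that its positivity is an instance of the
  -- general case.
  side : Fin 2 → Fin 2 → Carrier
  side = compound (1# - q) q

  side-same : (1# - q) + q ≈ 1#
  side-same = trans (+-assoc 1# (- q) q) (trans (+-congˡ (-‿inverseˡ q)) (+-identityʳ 1#))

  picks-∷ : ∀ (y : Y) w f → eval (picks (y ∷ w)) f ≈
            f (y , w) + q * eval (picks w) (λ (z , u) → f (z , y ∷ u))
  picks-∷ y w f = +-cong (*-identityˡ _) (eval-scale q _ (picks w) f)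

  marks-∷ : ∀ (y : Y) w f → eval (marks (y ∷ w)) f ≈
            f (y , map (_, after) w) +
            eval (marks w) (λ (z , r) → f (z , (y , before) ∷ r))
  marks-∷ y w f = +-cong (*-identityˡ _) (eval-map _ (marks w) f)

  picks-map : ∀ (h : Y → Z) w f → eval (picks (map h w)) f ≈
              eval (picks w) (λ (z , u) → f (h z , map h u))
  picks-map h []      f = refl
  picks-map h (y ∷ w) f = begin
    eval (picks (h y ∷ map h w)) f
      ≈⟨ picks-∷ _ _ f ⟩
    f (h y , map h w) + q * eval (picks (map h w)) (λ (z , u) → f (z , h y ∷ u))
      ≈⟨ +-congˡ (*-congˡ (picks-map h w _)) ⟩
    f (h y , map h w) + q * eval (picks w) (λ (z , u) → f (h z , h y ∷ map h u))
      ≈⟨ picks-∷ y w _ ⟨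
    eval (picks (y ∷ w)) (λ (z , u) → f (h z , map h u)) ∎

  picks-length : ∀ (w : List Y) → All (λ (_ , _ , u) → length w ≡ suc (length u)) (picks w)
  picks-length []      = []
  picks-length (y ∷ w) = ≡.refl ∷ scale-All q _ (All.map (≡.cong suc) (picks-length w))

  -- Removing z and then z′ from w contributes the power of q for the position
  -- of z in w; in the other order z is one position further left exactly if
  -- it was after z′.
  picks-marks : ∀ (w : List Y) (f : Y → Y → List (Y × Fin 2) → Carrier) →
    eval (picks w) (λ (z , u) → eval (marks u) (λ (z′ , r) → f z z′ r)) ≈
    eval (marks w) (λ (z′ , r) → eval (picks r) (λ ((z , ε) , r′) → side before ε * f z z′ r′))
  picks-marks []      f = refl
  picks-marks (y ∷ w) f = begin
    eval (picks (y ∷ w)) (λ (z , u) → eval (marks u) (λ (z′ , r) → f z z′ r))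
      ≈⟨ picks-∷ y w _ ⟩
    first + q * eval (picks w) (λ (z , u) → eval (marks (y ∷ u)) (λ (z′ , r) → f z z′ r))
      ≈⟨ +-congˡ (*-congˡ (trans (eval-cong (picks w) (λ (z , u) → marks-∷ y u _))
           (trans (eval-+ (picks w) _ _) (+-congˡ (picks-marks w _))))) ⟩
    first + q * (second + third)
      ≈⟨ solve 4 (λ q a b c → a :+ q :* (b :+ c) := q :* b :+ (a :+ q :* c))
           refl q first second third ⟩
    q * second + (first + q * third)
      ≈⟨ +-cong (sym rhs₁) (sym rhs₂) ⟩
    eval (picks (map (_, after) w)) (λ ((z , ε) , r′) → side before ε * f z y r′) +
    eval (marks w) (λ (z′ , r) →
      eval (picks ((y , before) ∷ r)) (λ ((z , ε) , r′) → side before ε * f z z′ r′))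
      ≈⟨ marks-∷ y w _ ⟨
    eval (marks (y ∷ w)) (λ (z′ , r) → eval (picks r) (λ ((z , ε) , r′) → side before ε * f z z′ r′)) ∎
    where
    first  = eval (marks w) (λ (z′ , r) → f y z′ r)
    second = eval (picks w) (λ (z , u) → f z y (map (_, after) u))
    third  = eval (marks w) (λ (z′ , r) → eval (picks r) (λ ((z , ε) , r′) →
               side before ε * f z z′ ((y , before) ∷ r′)))
    rhs₁ : eval (picks (map (_, after) w)) (λ ((z , ε) , r′) → side before ε * f z y r′)
           ≈ q * second
    rhs₁ = trans (picks-map (_, after) w _) (eval-*ₗ q (picks w) _)
    rhs₂ : eval (marks w) (λ (z′ , r) →
             eval (picks ((y , before) ∷ r)) (λ ((z , ε) , r′) → side before ε * f z z′ r′))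
           ≈ first + q * third
    rhs₂ = trans
      (eval-cong (marks w) λ (z′ , r) → trans (picks-∷ (y , before) r _)
        (+-congʳ (trans (*-congʳ side-same) (*-identityˡ _))))
      (trans (eval-+ (marks w) _ _) (+-congˡ (eval-*ₗ q (marks w) _)))

  -- q to the number of letters recorded as `before`; on entries of `marks` this is the power of q
  -- that `picks` carries.
  weight : List (Y × Fin 2) → Carrier
  weight []            = 1#
  weight ((_ , ε) ∷ r) = side after ε * weight r

  forget : List (Y × Fin 2) → List Y
  forget = map proj₁

  weight-after : (w : List Y) → weight (map (_, after) w) ≈ 1#
  weight-after []      = refl
  weight-after (y ∷ w) = trans (*-cong side-same (weight-after w)) (*-identityˡ 1#)

  forget-after : (w : List Y) → forget (map (_, after) w) ≡ w
  forget-after []      = ≡.refl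
  forget-after (y ∷ w) = ≡.cong (y ∷_) (forget-after w)

  picks≈marks : ∀ (w : List Y) f → eval (picks w) f ≈
                eval (marks w) (λ (z , r) → weight r * f (z , forget r))
  picks≈marks []      f = refl
  picks≈marks (y ∷ w) f = begin
    eval (picks (y ∷ w)) f
      ≈⟨ picks-∷ y w f ⟩
    f (y , w) + q * eval (picks w) (λ (z , u) → f (z , y ∷ u))
      ≈⟨ +-cong
           (sym (trans (*-cong (weight-after w) (reflexive (≡.cong (λ u → f (y , u)) (forget-after w))))
                       (*-identityˡ _)))
           (trans (*-congˡ (picks≈marks w _)) (trans (sym (eval-*ₗ q (marks w) _))
             (eval-cong (marks w) λ _ → sym (*-assoc _ _ _)))) ⟩
    weight (map (_, after) w) * f (y , forget (map (_, after) w)) +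
    eval (marks w) (λ (z , r) → q * weight r * f (z , y ∷ forget r))
      ≈⟨ marks-∷ y w _ ⟨
    eval (marks (y ∷ w)) (λ (z , r) → weight r * f (z , forget r)) ∎

  -- The weight is a product over the letters, so removing one of them merely splits off its factor,
  -- whichever it is.
  picks-weight : ∀ (r : List (Y × Fin 2)) h →
    eval (picks r) (λ ((z , ε) , r′) → side after ε * (weight r′ * h (z , forget r′))) ≈
    weight r * eval (picks (forget r)) h
  picks-weight []            h = sym (zeroʳ 1#)
  picks-weight ((y , ε) ∷ r) h = begin
    eval (picks ((y , ε) ∷ r)) (λ ((z , ε′) , r′) → side after ε′ * (weight r′ * h (z , forget r′)))
      ≈⟨ picks-∷ (y , ε) r _ ⟩
    side after ε * (weight r * h (y , forget r)) +
    q * eval (picks r) (λ ((z , ε′) , r′) →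
          side after ε′ * ((side after ε * weight r′) * h (z , y ∷ forget r′)))
      ≈⟨ +-congˡ (*-congˡ (trans
           (eval-cong (picks r) λ _ →
             solve 4 (λ a b w h → a :* ((b :* w) :* h) := b :* (a :* (w :* h))) refl _ _ _ _)
           (trans (eval-*ₗ _ (picks r) _) (*-congˡ (picks-weight r _))))) ⟩
    side after ε * (weight r * h (y , forget r)) +
    q * (side after ε * (weight r * eval (picks (forget r)) (λ (z , u) → h (z , y ∷ u))))
      ≈⟨ solve 5 (λ q a w h e → a :* (w :* h) :+ q :* (a :* (w :* e)) :=
                                (a :* w) :* (h :+ q :* e))
           refl q (side after ε) (weight r) _ _ ⟩
    side after ε * weight r *
    (h (y , forget r) + q * eval (picks (forget r)) (λ (z , u) → h (z , y ∷ u)))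
      ≈⟨ *-congˡ (picks-∷ y (forget r) h) ⟨
    side after ε * weight r * eval (picks (y ∷ forget r)) h ∎

  module _ {Y : Set} (B : Y → Y → Carrier) where

    -- When all letters on the left are `after`, each letter of r pays the same factor under every
    -- matching, and these factors multiply to its weight.
    gram-after : ∀ v r → gram (B ⊗ side) (map (_, after) v) r ≈ weight r * gram B v (forget r)
    gram-after []      []      = sym (*-identityˡ 1#)
    gram-after []      (_ ∷ _) = sym (zeroʳ _)
    gram-after (s ∷ v) r       = trans
      (eval-cong (picks r) λ ((z , ε) , r′) → trans (*-congˡ (gram-after v r′))
        (solve 4 (λ b a w g → (b :* a) :* (w :* g) := a :* (w :* (b :* g))) refl
          (B s z) (side after ε) (weight r′) (gram B v (forget r′))))
      (picks-weight r _)

    -- Expansion of the Gram matrix along an arbitrary letter of the first word.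
    gram-mark : ∀ {v z r} → Mark v z r → ∀ w → gram B v w ≈
                eval (marks w) (λ (z′ , r′) → B z z′ * gram (B ⊗ side) r r′)
    gram-mark (here {y} {v}) w = trans (picks≈marks w _)
      (eval-cong (marks w) λ (z′ , r′) → trans
        (solve 3 (λ w b g → w :* (b :* g) := b :* (w :* g)) refl _ _ _)
        (*-congˡ (sym (gram-after v r′))))
    gram-mark (there {y} {v} {z} {r} m) w = begin
      eval (picks w) (λ (x , u) → B y x * gram B v u)
        ≈⟨ eval-cong (picks w) (λ (x , u) →
             trans (*-congˡ (gram-mark m u)) (sym (eval-*ₗ _ (marks u) _))) ⟩
      eval (picks w) (λ (x , u) → eval (marks u) (λ (z′ , r′) →
        B y x * (B z z′ * gram (B ⊗ side) r r′)))
        -- The letter y stands before the expanded one. Exchanging the two removals produces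
        -- `side before ε`, the factor that y with record `before` pays in the marked Gram matrix.
        ≈⟨ picks-marks w _ ⟩
      eval (marks w) (λ (z′ , r′) → eval (picks r′) (λ ((x , ε) , r″) →
        side before ε * (B y x * (B z z′ * gram (B ⊗ side) r r″))))
        ≈⟨ eval-cong (marks w) (λ (z′ , r′) → trans
             (eval-cong (picks r′) λ ((x , ε) , r″) →
               solve 4 (λ s b b′ g → s :* (b :* (b′ :* g)) := b′ :* ((b :* s) :* g)) refl
                 (side before ε) (B y x) (B z z′) (gram (B ⊗ side) r r″))
             (eval-*ₗ _ (picks r′) _)) ⟩
      eval (marks w) (λ (z′ , r′) → B z z′ * gram (B ⊗ side) ((y , before) ∷ r) r′) ∎

    -- A permutation and its inverse have equally many inversions, so expansion along the first
    -- column uses the same powers of q as along the first row. Symmetry of G and the adjointness of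
    -- creators and annihilators rest on this.
    gram-expandʳ : ∀ v t w → gram B v (t ∷ w) ≈
                          eval (picks v) (λ (z , u) → B z t * gram B u w)
    gram-expandʳ []      t w = refl
    gram-expandʳ (s ∷ v) t w = begin
      eval (picks (t ∷ w)) (λ (z , u) → B s z * gram B v u)
        ≈⟨ picks-∷ t w _ ⟩
      B s t * gram B v w + q * eval (picks w) (λ (z , u) → B s z * gram B v (t ∷ u))
        ≈⟨ +-congˡ (*-congˡ (begin
             eval (picks w) (λ (z , u) → B s z * gram B v (t ∷ u))
               ≈⟨ eval-cong (picks w) (λ (z , u) → trans (*-congˡ (gram-expandʳ v t u))
                    (sym (eval-*ₗ _ (picks v) _))) ⟩
             eval (picks w) (λ (z , u) → eval (picks v) (λ (z′ , u′) → B s z * (B z′ t * gram B u′ u)))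
               ≈⟨ eval-swap (picks w) (picks v) _ ⟩
             eval (picks v) (λ (z′ , u′) → eval (picks w) (λ (z , u) → B s z * (B z′ t * gram B u′ u)))
               ≈⟨ eval-cong (picks v) (λ (z′ , u′) → trans
                    (eval-cong (picks w) λ _ → solve 3 (λ a b g → a :* (b :* g) := b :* (a :* g)) refl _ _ _)
                    (eval-*ₗ _ (picks w) _)) ⟩
             eval (picks v) (λ (z′ , u′) → B z′ t * gram B (s ∷ u′) w) ∎)) ⟩
      B s t * gram B v w + q * eval (picks v) (λ (z , u) → B z t * gram B (s ∷ u) w)
        ≈⟨ picks-∷ s v _ ⟨
      eval (picks (s ∷ v)) (λ (z , u) → B z t * gram B u w) ∎

    gram-sym : (∀ y z → B y z ≈ B z y) → ∀ v w → gram B v w ≈ gram B w v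
    gram-sym B-sym []      []      = refl
    gram-sym B-sym []      (_ ∷ _) = refl
    gram-sym B-sym (s ∷ v) w       = trans
      (eval-cong (picks w) λ (z , u) → *-cong (B-sym s z) (gram-sym B-sym v u))
      (sym (gram-expandʳ w s v))

    gram≈0 : ∀ v w → length v ≢ length w → gram B v w ≈ 0#
    gram≈0 []      []      p = contradiction ≡.refl p
    gram≈0 []      (_ ∷ _) p = refl
    gram≈0 (s ∷ v) w       p = eval-0-All (picks w) (All.map
      (λ {(_ , z , u)} |w|≡1+|u| → trans
        (*-congˡ (gram≈0 v u λ |v|≡|u| →
          p (≡.trans (≡.cong suc |v|≡|u|) (≡.sym |w|≡1+|u|))))
        (zeroʳ _))
      (picks-length w))

  -- The source of the factor n: the expansions along the n letters of a word all have the same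
  -- value.
  marks-const : ∀ (w : List Y) {f x} → (∀ {z r} → Mark w z r → f (z , r) ≈ x) →
                eval (marks w) f ≈ fromℕ (length w) * x
  marks-const []      p = sym (zeroˡ _)
  marks-const (y ∷ w) p = trans (marks-∷ y w _)
    (trans (+-cong (p here) (marks-const w (p ∘ there)))
      (trans (+-congʳ (sym (*-identityˡ _))) (sym (distribʳ _ _ _))))

-- Positive definiteness of the q-deformed Gram matrix.

module GramPositivity {c ℓ₁ ℓ₂ v ℓv} (ℝ : RealNumbers c ℓ₁ ℓ₂) (q : RealNumbers.Carrier ℝ)
                      (V : Module (RealNumbers.commutativeRing ℝ) v ℓv) where
  open RealNumbers ℝ hiding (zero)
  open OrderedField ℝ
  open Combinations ℝ
  open QGram ℝ q
  open Positivity ℝ V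
  open Module V
  open Evaluation V using () renaming
    ( eval to evalⱽ; eval-cong to evalⱽ-cong; eval-map to evalⱽ-map; eval-0 to evalⱽ-0
    )
  open import Relation.Binary.Reasoning.Setoid setoid

  private variable
    Y : Set

  -- `marks` with the length tracked, which drives the induction. The recursion stops at a single
  -- letter because it is only defined on nonempty words.
  vecMarks : ∀ {n} → Vec Y (suc n) → LC (Y × Vec (Y × Fin 2) n)
  vecMarks {n = zero}  (y ∷ []) = [ (1# , y , []) ]
  vecMarks {n = suc n} (y ∷ w)  = (1# , y , Vec.map (_, after) w) ∷
    scale 1# (λ (z , r) → z , (y , before) ∷ r) (vecMarks w)

  eval-vecMarks : ∀ {n} (w : Vec Y (suc n)) f →
    eval (vecMarks w) (λ (z , r) → f (z , toList r)) ≈ eval (marks (toList w)) f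
  eval-vecMarks {n = zero}  (y ∷ []) f = refl
  eval-vecMarks {n = suc n} (y ∷ w)  f = trans
    (+-cong (trans (*-identityˡ _) (reflexive (≡.cong (λ r → f (y , r)) (Vecₚ.toList-map (_, after) w))))
            (trans (eval-map _ (vecMarks w) _) (eval-vecMarks w _)))
    (sym (marks-∷ y (toList w) f))

  ifAllAfter : ∀ {n} → Vec (Y × Fin 2) n → Carrierᴹ → Carrierᴹ
  ifAllAfter []                 u = u
  ifAllAfter ((_ , before) ∷ _) u = 0ᴹ
  ifAllAfter ((_ , after) ∷ r)  u = ifAllAfter r u

  ifAllAfter-after : ∀ {n} (w : Vec Y n) u → ifAllAfter (Vec.map (_, after) w) u ≡ u
  ifAllAfter-after []      u = ≡.refl
  ifAllAfter-after (y ∷ w) u = ifAllAfter-after w u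

  -- Only the mark at the first letter has all other letters after it, hence
  -- w can be recovered from vecMarks w.
  unmark : ∀ {n} → (Vec Y (suc n) → Carrierᴹ) → Y × Vec (Y × Fin 2) n → Carrierᴹ
  unmark φ (y , r) = ifAllAfter r (φ (y ∷ Vec.map proj₁ r))

  unmark-after : ∀ {n} (φ : Vec Y (suc n) → Carrierᴹ) y w →
                 unmark φ (y , Vec.map (_, after) w) ≡ φ (y ∷ w)
  unmark-after φ y w = ≡.trans (ifAllAfter-after w _)
    (≡.cong (λ u → φ (y ∷ u)) (≡.trans (≡.sym (Vecₚ.map-∘ proj₁ (_, after) w)) (Vecₚ.map-id w)))

  eval-unmark : ∀ {n} φ (w : Vec Y (suc n)) → evalⱽ (vecMarks w) (unmark φ) ≈ᴹ φ w
  eval-unmark {n = zero}  φ (y ∷ []) = ≈ᴹ-trans (+ᴹ-identityʳ _) (*ₗ-identityˡ _)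
  eval-unmark {n = suc n} φ (y ∷ w)  = ≈ᴹ-trans
    (+ᴹ-cong (≈ᴹ-trans (*ₗ-identityˡ _) (≈ᴹ-reflexive (unmark-after φ y w)))
             (≈ᴹ-trans (evalⱽ-map _ (vecMarks w) _) (evalⱽ-0 (vecMarks w) λ _ → ≈ᴹ-refl)))
    (+ᴹ-identityʳ _)

  vecGram : (Y → Y → Carrier) → ∀ {n} → Vec Y n → Vec Y n → Carrier
  vecGram B v w = gram B (toList v) (toList w)

  marks-isometry : ∀ (B : Y → Y → Carrier) {n} (v w : Vec Y (suc n)) →
    fromℕ (suc n) * vecGram B v w ≈ ⟪ B ⊗ vecGram (B ⊗ side) ⟫ (vecMarks v) (vecMarks w)
  marks-isometry B {n} v w = sym (begin
    eval (vecMarks v) (λ (z , r) → eval (vecMarks w) (λ (z′ , r′) →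
      B z z′ * vecGram (B ⊗ side) r r′))
      ≈⟨ eval-cong (vecMarks v) (λ _ → eval-vecMarks w _) ⟩
    eval (vecMarks v) (λ (z , r) → eval (marks (toList w)) (λ (z′ , r′) →
      B z z′ * gram (B ⊗ side) (toList r) r′))
      ≈⟨ eval-vecMarks v _ ⟩
    eval (marks (toList v)) (λ (z , r) → eval (marks (toList w)) (λ (z′ , r′) →
      B z z′ * gram (B ⊗ side) r r′))
      ≈⟨ marks-const (toList v) (λ m → sym (gram-mark B m (toList w))) ⟩
    fromℕ (length (toList v)) * vecGram B v w
      ≡⟨ ≡.cong (λ k → fromℕ k * vecGram B v w) (Vecₚ.length-toList v) ⟩
    fromℕ (suc n) * vecGram B v w ∎)

  module _ (side-tp : TensorPositive side) where

    vecGram-pd : ∀ n {B : Y → Y → Carrier} → TensorPositive B →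
                 PositiveDefinite (vecGram B {n})
    -- The empty word is the only one of length 0, so the form is the square of the sum s of all
    -- coefficients, and `d` amounts to s times that word.
    vecGram-pd zero {B} _ d = record
      { nonneg   = ≼-congʳ (sym Q≈) (nonneg-square s)
      ; definite = λ Q≈0 φ → ≈ᴹ-trans
          (evalⱽ-cong d (λ { [] → ≈ᴹ-sym (*ₗ-identityˡ (φ [])) }))
          (≈ᴹ-trans (eval-*-vector V d (λ _ → 1#) (φ []))
            (≈ᴹ-trans (*ₗ-cong (square≈0 (trans (sym Q≈) Q≈0)) ≈ᴹ-refl) (*ₗ-zeroˡ _)))
      }
      where
      s = eval d (λ _ → 1#)
      Q≈ : ⟪ vecGram B ⟫ d d ≈ s * s
      Q≈ = trans (eval-cong d λ { [] → trans (eval-cong d λ { [] → refl }) (sym (*-identityʳ s)) })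
                 (eval-*ₗ s d _)
    vecGram-pd (suc n) B-tp = pullback vecMarks (0<fromℕ ℝ n) (marks-isometry _) unmark eval-unmark
      -- `B-tp` is applied with the smaller Gram matrix, over recording letters, as the other
      -- factor.
      (B-tp (vecGram-pd n (⊗-tensorPositive B-tp side-tp)))

    gram-pd : {B : Y → Y → Carrier} → TensorPositive B → PositiveDefinite (gram B)
    gram-pd {Y} {B} B-tp = reindex (λ w → length w , fromList w) (λ (_ , w) → toList w)
      Vecₚ.toList∘fromList
      (λ v w → reflexive (≡.sym
        (≡.cong₂ (gram B) (Vecₚ.toList∘fromList v) (Vecₚ.toList∘fromList w))))
      (graded-sum {X = Vec Y} (λ (n , v) (n′ , w) n≢n′ → gram≈0 B (toList v) (toList w)
           λ eq → n≢n′ (≡.trans (≡.sym (Vecₚ.length-toList v)) (≡.trans eq (Vecₚ.length-toList w))))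
        (λ n → vecGram-pd n B-tp))

-- The exponents β and the admissible range of q.

β-≡ : ∀ {m} (k : Fin m) → β m k k ≡ 0
β-≡ {m} k = ≡.cong (λ b → if b then 0 else 1) (dec-true (_ ℤ∣.∣? _)
  (ℤ∣.∣m∣n⇒∣m-n
    (≡.subst (+ m ℤ∣.∣_) (≡.sym (ℤₚ.+-inverseʳ (+ toℕ k))) (ℤ∣.∣ᵤ⇒∣ (m ℕ∣.∣0)))
    ℤ∣.∣-refl))

-- Since |l - k| < m, divisibility of l - k - m by m, hence of l - k, would force l = k.
β-≢ : ∀ {m} {k l : Fin m} → k ≢ l → β m k l ≡ 1
β-≢ {m@(suc _)} {k} {l} k≢l = ≡.cong (λ b → if b then 0 else 1) (dec-false (_ ℤ∣.∣? _) not-∣)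
  where
  d = + toℕ l ℤ.- + toℕ k
  ∣d∣<m : ℤ.∣ d ∣ ℕ.< m
  ∣d∣<m = ℕₚ.≤-<-trans
    (≡.subst (λ i → ℤ.∣ i ∣ ℕ.≤ toℕ l ℕ.⊔ toℕ k) (≡.sym (ℤₚ.m-n≡m⊖n (toℕ l) (toℕ k)))
      (ℤₚ.∣m⊝n∣≤m⊔n (toℕ l) (toℕ k)))
    (ℕₚ.⊔-lub (Finₚ.toℕ<n l) (Finₚ.toℕ<n k))
  d≢0 : ℤ.∣ d ∣ ≢ 0
  d≢0 eq = k≢l (Finₚ.toℕ-injective (ℤₚ.+-injective
    (≡.sym (ℤₚ.i-j≡0⇒i≡j _ _ (ℤₚ.∣i∣≡0⇒i≡0 eq)))))
  not-∣ : ¬ (+ m ℤ∣.∣ (d ℤ.- + m))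
  not-∣ m∣d-m = ℕ∣.>⇒∤ {{ℕ.≢-nonZero d≢0}} ∣d∣<m
    (ℤ∣.∣⇒∣ᵤ (ℤ∣.∣m+n∣n⇒∣m {m = d} m∣d-m (ℤ∣.∣m⇒∣-m ℤ∣.∣-refl)))

module AdmissibleBounds {c ℓ₁ ℓ₂} (ℝ : RealNumbers c ℓ₁ ℓ₂) (q : RealNumbers.Carrier ℝ) where
  open RealNumbers ℝ hiding (zero)
  open OrderedField ℝ
  open Compound ℝ
  open QGram ℝ q
  open RingProperties ring using (-‿distribʳ-*; -‿involutive; -‿+-comm)
  open NatCoeffSolver commutativeSemiring using (solve; _:=_; _:+_; _:*_; con)
  open import Relation.Binary.Reasoning.Setoid setoid

  private
    -- The eigenvalue of (1 - q) I + q J on the all-ones vector.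
    top-eigenvalue : ∀ F → (1# - q) + (1# + F) * q ≈ 1# + F * q
    top-eigenvalue F = begin
      (1# - q) + (1# + F) * q ≈⟨ +-congˡ (trans (distribʳ q 1# F) (+-congʳ (*-identityˡ q))) ⟩
      (1# - q) + (q + F * q)  ≈⟨ +-assoc _ _ _ ⟨
      ((1# - q) + q) + F * q  ≈⟨ +-congʳ side-same ⟩
      1# + F * q              ∎

  admissible⇒<1 : ∀ m → 1 ℕ.≤ m → Admissible ℝ m q → 0# < 1# - q
  admissible⇒<1 (suc zero)    _ (adm₁ , _) = <⇒pos (proj₂ (adm₁ ≡.refl))
  admissible⇒<1 (suc (suc n)) _ (_ , adm₂) = <⇒pos (proj₂ (adm₂ (ℕ.s≤s (ℕ.s≤s ℕ.z≤n))))

  -- The eigenvalues at the all-ones vector for the letters of one mode, 1 + (m - 1) q, and for the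
  -- records, 1 + q. For m = 1 the first is 1 and the second is the bound -1 < q; for m > 1, m - 1
  -- times the second is the first plus m - 2.
  admissible⇒compound : ∀ m → 1 ℕ.≤ m → Admissible ℝ m q →
    0# < (1# - q) + fromℕ m * q × 0# < (1# - q) + fromℕ 2 * q
  admissible⇒compound (suc zero) _ (adm₁ , _) =
    <-cong refl (sym (trans (top-eigenvalue 0#) (trans (+-congˡ (zeroˡ q)) (+-identityʳ 1#)))) 0<1 ,
    <-cong refl (begin
      q - - 1#                 ≈⟨ +-congˡ (-‿involutive 1#) ⟩
      q + 1#                   ≈⟨ solve 1 (λ q → q :+ con 1 := con 1 :+ (con 1 :+ con 0) :* q) refl q ⟩
      1# + (1# + 0#) * q       ≈⟨ top-eigenvalue (1# + 0#) ⟨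
      (1# - q) + fromℕ 2 * q   ∎)
      (<⇒pos (proj₁ (adm₁ ≡.refl)))
  admissible⇒compound (suc (suc n)) _ (_ , adm₂) =
    <-cong refl (sym (top-eigenvalue F)) 0<1+Fq ,
    <-cong refl (trans (solve 1 (λ q → con 1 :+ q := con 1 :+ (con 1 :+ con 0) :* q) refl q)
      (sym (top-eigenvalue (1# + 0#)))) 0<1+q
    where
    F = fromℕ (suc n)
    1<m = ℕ.s≤s (ℕ.s≤s ℕ.z≤n)
    s = 1/[1-_] ℝ (suc (suc n)) 1<m
    -Fs≈1 : F * (- s) ≈ 1#
    -Fs≈1 = begin
      F * (- s)               ≈⟨ -‿distribʳ-* F s ⟨
      - (F * s)               ≈⟨ -‿cong (*-comm F s) ⟩
      - (s * F)               ≈⟨ -‿distribʳ-* s F ⟩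
      s * (- F)               ≈⟨ *-congˡ (+-identityˡ _) ⟨
      s * (0# - F)            ≈⟨ *-congˡ (+-congʳ (-‿inverseʳ 1#)) ⟨
      s * ((1# - 1#) - F)     ≈⟨ *-congˡ (trans (+-assoc _ _ _) (+-congˡ (-‿+-comm 1# F))) ⟩
      s * (1# - (1# + F))     ≈⟨ proj₁ (proj₂ (#⇒invertible (inj₁ (1<fromℕ ℝ (suc (suc n)) 1<m)))) ⟩
      1#                      ∎
    -- Here the bound 1 / (1 - m) acts: multiplying q - 1 / (1 - m) > 0 by m - 1 gives (m - 1) q + 1
    -- > 0.
    0<1+Fq : 0# < 1# + F * q
    0<1+Fq = <-cong refl
      (trans (distribˡ F q (- s)) (trans (+-congˡ -Fs≈1) (+-comm _ _)))
      (*-pos (0<fromℕ ℝ n) (<⇒pos (proj₁ (adm₂ 1<m))))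
    0<1+q : 0# < 1# + q
    0<1+q = pos-cancelˡ (0<fromℕ ℝ n) (<-cong refl
      (solve 2 (λ N q → (con 1 :+ (con 1 :+ N) :* q) :+ N :* con 1 := (con 1 :+ N) :* (con 1 :+ q))
        refl (fromℕ n) q)
      (pos-+-fromℕ n 0<1+Fq 0<1))

-- The form B on single letters.

module LetterForm {c ℓ₁ ℓ₂} (ℝ : RealNumbers c ℓ₁ ℓ₂) (m : ℕ) (q : RealNumbers.Carrier ℝ) where
  open RealNumbers ℝ hiding (zero)
  open Combinations ℝ
  open Compound ℝ
  open QGram ℝ q
  open import Relation.Binary.Reasoning.Setoid setoid

  Letter : Set
  Letter = ℕ × Fin m

  -- The inhomogeneous term of the commutation relation, with the annihilator as first argument and
  -- the creator as second.
  letterForm : Letter → Letter → Carrier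
  letterForm (j , l) (i , k) = (q ^ β m k l) * δ ℝ i j

  δ-≡ : ∀ i → δ ℝ i i ≡ 1#
  δ-≡ i = ≡.cong (λ b → if b then 1# else 0#) (dec-true (i ℕₚ.≟ i) ≡.refl)

  δ-≢ : ∀ {i j} → i ≢ j → δ ℝ i j ≡ 0#
  δ-≢ {i} {j} i≢j = ≡.cong (λ b → if b then 1# else 0#) (dec-false (i ℕₚ.≟ j) i≢j)

  β-sym : ∀ k l → β m k l ≡ β m l k
  β-sym k l with k Finₚ.≟ l
  ... | yes ≡.refl = ≡.refl
  ... | no  k≢l    = ≡.trans (β-≢ k≢l) (≡.sym (β-≢ (k≢l ∘ ≡.sym)))

  δ-sym : ∀ i j → δ ℝ i j ≡ δ ℝ j i
  δ-sym i j with i ℕₚ.≟ j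
  ... | yes ≡.refl = ≡.refl
  ... | no  i≢j    = ≡.trans (δ-≢ i≢j) (≡.sym (δ-≢ (i≢j ∘ ≡.sym)))

  letterForm-sym : ∀ s t → letterForm s t ≈ letterForm t s
  letterForm-sym (j , l) (i , k) =
    reflexive (≡.cong₂ (λ b d → (q ^ b) * d) (β-sym k l) (δ-sym i j))

  letterForm-same : ∀ i k l → letterForm (i , k) (i , l) ≈ compound (1# - q) q k l
  letterForm-same i k l = trans
    (trans (*-congˡ (reflexive (δ-≡ i))) (*-identityʳ _)) power
    where
    power : q ^ β m l k ≈ compound (1# - q) q k l
    power with k Finₚ.≟ l
    ... | yes ≡.refl = trans (reflexive (≡.cong (q ^_) (β-≡ k)))
      (trans (sym side-same) (sym (compound-≡ _ _ k)))
    ... | no  k≢l    = trans (reflexive (≡.cong (q ^_) (β-≢ (k≢l ∘ ≡.sym))))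
      (trans (*-identityʳ q) (sym (compound-≢ _ _ k≢l)))

  module _ {v ℓv} (V : Module commutativeRing v ℓv)
           (1≤m : 1 ℕ.≤ m) (adm : Admissible ℝ m q) where
    open AdmissibleBounds ℝ q
    open Positivity ℝ V
    open CompoundPositivity ℝ V

    side-tensorPositive : TensorPositive side
    side-tensorPositive = compound-tensorPositive 2 (admissible⇒<1 m 1≤m adm)
                            (proj₂ (admissible⇒compound m 1≤m adm))

    -- The factor δ makes distinct modes i orthogonal, and within one mode the form is (1 - q) I + q
    -- J.
    letterForm-tensorPositive : TensorPositive letterForm
    letterForm-tensorPositive {Y} {K} K-pd = reindex
      (λ { ((i , k) , y) → i , (k , y) }) (λ { (i , (k , y)) → (i , k) , y })
      (λ _ → ≡.refl) (λ _ _ → refl)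
      (graded-sum {K = L} L≈0 λ i → pd-cong
        (λ { (k , _) (l , _) → *-congʳ (letterForm-same i k l) })
        (compound-tensorPositive m (admissible⇒<1 m 1≤m adm)
          (proj₁ (admissible⇒compound m 1≤m adm)) K-pd))
      where
      L : ℕ × (Fin m × Y) → ℕ × (Fin m × Y) → Carrier
      L (i , (k , y)) (j , (l , z)) = letterForm (i , k) (j , l) * K y z

      L≈0 : ∀ x y → proj₁ x ≢ proj₁ y → L x y ≈ 0#
      L≈0 (i , _) (j , _) i≢j = trans
        (*-congʳ (trans (*-congˡ (reflexive (δ-≢ (i≢j ∘ ≡.sym)))) (zeroʳ _)))
        (zeroˡ _)

-- Normal ordering and the vacuum expectation.

module NormalOrdering {c ℓ₁ ℓ₂} (ℝ : RealNumbers c ℓ₁ ℓ₂) (m : ℕ) (q : RealNumbers.Carrier ℝ) where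
  open RealNumbers ℝ hiding (zero)
  open Combinations ℝ
  open QGram ℝ q
  open LetterForm ℝ m q
  open QuonAlgebra ℝ m q
  open NatCoeffSolver commutativeSemiring using (solve; _:=_; _:+_; _:*_; con)
  open import Relation.Binary.Reasoning.Setoid setoid

  Word : Set
  Word = List Letter

  -- What remains of an annihilator moved to the right through a word of creators until it meets the
  -- vacuum: q for each letter passed, `letterForm` where it is absorbed.
  annihilate : Letter → Word → LC Word
  annihilate t []      = []
  annihilate t (z ∷ w) = (letterForm t z , w) ∷ scale q (z ∷_) (annihilate t w)

  annihilate-length : ∀ t w → All (λ (_ , u) → length w ≡ suc (length u)) (annihilate t w)
  annihilate-length t []      = []
  annihilate-length t (z ∷ w) =
    ≡.refl ∷ scale-All q (z ∷_) (All.map (≡.cong suc) (annihilate-length t w))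

  eval-annihilate : ∀ t w f → eval (annihilate t w) f ≈
                    eval (picks w) (λ (z , u) → letterForm t z * f u)
  eval-annihilate t []      f = refl
  eval-annihilate t (z ∷ w) f = trans
    (+-congˡ (trans (eval-scale q _ (annihilate t w) f) (*-congˡ (eval-annihilate t w _))))
    (sym (picks-∷ z w _))

  -- The Fock representation on formal combinations of words; `act x w` holds the coordinates of x
  -- applied to the state of w.
  act : 𝐀 → Word → LC Word
  act (const r) w = [ (r , w) ]
  act (a j l)   w = annihilate (j , l) w
  act (a† i k)  w = [ (1# , (i , k) ∷ w) ]
  act (x +ᴬ y)  w = act x w ++ act y w
  act (x *ᴬ y)  w = bind (act y w) (act x)

  eval-single : ∀ r w (f : Word → Carrier) → eval [ (r , w) ] f ≈ r * f w
  eval-single r w f = +-identityʳ _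

  eval-const* : ∀ r x w f → eval (act (const r *ᴬ x) w) f ≈ r * eval (act x w) f
  eval-const* r x w f = trans (eval-bind (act x w) _ f)
    (trans (eval-cong (act x w) λ u → eval-single r u f) (eval-*ₗ r (act x w) f))

  eval-*const : ∀ r x w f → eval (act (x *ᴬ const r) w) f ≈ r * eval (act x w) f
  eval-*const r x w f = trans (eval-bind [ (r , w) ] (act x) f)
    (eval-single r w (λ u → eval (act x u) f))

  act-cong : ∀ {x y} → x ≈ᴬ y → ∀ w f → eval (act x w) f ≈ eval (act y w) f
  act-cong reflᴬ w f = refl
  act-cong (symᴬ p) w f = sym (act-cong p w f)
  act-cong (transᴬ p r) w f = trans (act-cong p w f) (act-cong r w f)
  act-cong (+-congᴬ {x} {x′} {y} {y′} p r) w f = trans (eval-++ (act x w) _ f)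
    (trans (+-cong (act-cong p w f) (act-cong r w f)) (sym (eval-++ (act x′ w) _ f)))
  act-cong (*-congᴬ {x} {x′} {y} {y′} p r) w f = begin
    eval (bind (act y w) (act x)) f           ≈⟨ eval-bind (act y w) (act x) f ⟩
    eval (act y w) (λ u → eval (act x u) f)   ≈⟨ act-cong r w _ ⟩
    eval (act y′ w) (λ u → eval (act x u) f)  ≈⟨ eval-cong (act y′ w) (λ u → act-cong p u f) ⟩
    eval (act y′ w) (λ u → eval (act x′ u) f) ≈⟨ eval-bind (act y′ w) (act x′) f ⟨
    eval (bind (act y′ w) (act x′)) f         ∎
  act-cong (const-cong p) w f = +-congʳ (*-congʳ p)
  act-cong (const-+ r s) w f = solve 3 (λ r s f → (r :+ s) :* f :+ con 0 := r :* f :+ (s :* f :+ con 0))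
    refl r s (f w)
  act-cong (const-* r s) w f = sym (trans (eval-const* r (const s) w f)
    (solve 3 (λ r s f → r :* (s :* f :+ con 0) := r :* s :* f :+ con 0) refl r s (f w)))
  act-cong (const-comm r x) w f = trans (eval-const* r x w f) (sym (eval-*const r x w f))
  act-cong (+-assocᴬ x y z) w f = begin
    eval ((act x w ++ act y w) ++ act z w) f
      ≈⟨ trans (eval-++ (act x w ++ act y w) _ f) (+-congʳ (eval-++ (act x w) _ f)) ⟩
    (eval (act x w) f + eval (act y w) f) + eval (act z w) f
      ≈⟨ +-assoc _ _ _ ⟩
    eval (act x w) f + (eval (act y w) f + eval (act z w) f)
      ≈⟨ trans (eval-++ (act x w) _ f) (+-congˡ (eval-++ (act y w) _ f)) ⟨
    eval (act x w ++ (act y w ++ act z w)) f ∎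
  act-cong (+-commᴬ x y) w f = trans (eval-++ (act x w) _ f)
    (trans (+-comm _ _) (sym (eval-++ (act y w) _ f)))
  act-cong (+-identityˡᴬ x) w f = trans (+-congʳ (zeroˡ _)) (+-identityˡ _)
  act-cong (*-assocᴬ x y z) w f = begin
    eval (bind (act z w) (act (x *ᴬ y))) f
      ≈⟨ eval-bind (act z w) _ f ⟩
    eval (act z w) (λ u → eval (bind (act y u) (act x)) f)
      ≈⟨ eval-cong (act z w) (λ u → eval-bind (act y u) (act x) f) ⟩
    eval (act z w) (λ u → eval (act y u) (λ u′ → eval (act x u′) f))
      ≈⟨ eval-bind (act z w) (act y) _ ⟨
    eval (bind (act z w) (act y)) (λ u → eval (act x u) f)
      ≈⟨ eval-bind (bind (act z w) (act y)) (act x) f ⟨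
    eval (bind (bind (act z w) (act y)) (act x)) f ∎
  act-cong (*-identityˡᴬ x) w f = trans (eval-const* 1# x w f) (*-identityˡ _)
  act-cong (zeroˡᴬ x) w f = trans (eval-const* 0# x w f)
    (trans (zeroˡ _) (sym (trans (+-identityʳ _) (zeroˡ _))))
  act-cong (distribˡᴬ x y z) w f = begin
    eval (bind (act y w ++ act z w) (act x)) f
      ≈⟨ eval-bind (act y w ++ act z w) (act x) f ⟩
    eval (act y w ++ act z w) (λ u → eval (act x u) f)
      ≈⟨ eval-++ (act y w) (act z w) _ ⟩
    eval (act y w) (λ u → eval (act x u) f) + eval (act z w) (λ u → eval (act x u) f)
      ≈⟨ +-cong (eval-bind (act y w) (act x) f) (eval-bind (act z w) (act x) f) ⟨
    eval (bind (act y w) (act x)) f + eval (bind (act z w) (act x)) f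
      ≈⟨ eval-++ (bind (act y w) (act x)) _ f ⟨
    eval (bind (act y w) (act x) ++ bind (act z w) (act x)) f ∎
  act-cong (distribʳᴬ x y z) w f = begin
    eval (bind (act x w) (act (y +ᴬ z))) f
      ≈⟨ eval-bind (act x w) _ f ⟩
    eval (act x w) (λ u → eval (act y u ++ act z u) f)
      ≈⟨ eval-cong (act x w) (λ u → eval-++ (act y u) (act z u) f) ⟩
    eval (act x w) (λ u → eval (act y u) f + eval (act z u) f)
      ≈⟨ eval-+ (act x w) _ _ ⟩
    eval (act x w) (λ u → eval (act y u) f) + eval (act x w) (λ u → eval (act z u) f)
      ≈⟨ +-cong (eval-bind (act x w) (act y) f) (eval-bind (act x w) (act z) f) ⟨
    eval (bind (act x w) (act y)) f + eval (bind (act x w) (act z)) f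
      ≈⟨ eval-++ (bind (act x w) (act y)) _ f ⟨
    eval (bind (act x w) (act y) ++ bind (act x w) (act z)) f ∎
  -- The head term and the tail term of `annihilate` on a word starting with (i , k) are the two
  -- terms of the relation.
  act-cong (commutation i k j l) w f = begin
    eval (bind [ (1# , (i , k) ∷ w) ] (annihilate (j , l))) f
      ≈⟨ trans (eval-bind [ (1# , (i , k) ∷ w) ] (annihilate (j , l)) f)
           (eval-return ((i , k) ∷ w) λ u → eval (annihilate (j , l) u) f) ⟩
    B * f w + eval (scale q ((i , k) ∷_) (annihilate (j , l) w)) f
      ≈⟨ +-congˡ (eval-scale q _ (annihilate (j , l) w) f) ⟩
    B * f w + q * eval (annihilate (j , l) w) (λ u → f ((i , k) ∷ u))
      ≈⟨ +-comm _ _ ⟩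
    q * eval (annihilate (j , l) w) (λ u → f ((i , k) ∷ u)) + B * f w
      ≈⟨ +-cong
           (trans (eval-const* q (a† i k *ᴬ a j l) w f)
             (*-congˡ (trans (eval-bind (annihilate (j , l) w) _ f)
               (eval-cong (annihilate (j , l) w) λ u → eval-return ((i , k) ∷ u) f))))
           (eval-single B w f) ⟨
    eval (act (const q *ᴬ (a† i k *ᴬ a j l)) w) f + eval (act (const B) w) f
      ≈⟨ eval-++ (act (const q *ᴬ (a† i k *ᴬ a j l)) w) _ f ⟨
    eval (act (const q *ᴬ (a† i k *ᴬ a j l) +ᴬ const B) w) f ∎
    where B = (q ^ β m k l) * δ ℝ i j

  normal : 𝐀 → LC Word
  normal x = act x []

  G : Word → Word → Carrier
  G = gram letterForm

  -- G [] is the indicator function of the empty word.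
  vacuumExpectation : VacuumExpectation
  vacuumExpectation = record
    { ⟨0∣_∣0⟩ = λ x → eval (normal x) (G [])
    ; cong    = λ p → act-cong p [] (G [])
    ; +-homo  = λ x y → eval-++ (normal x) (normal y) (G [])
    ; *-homo  = λ r x → eval-const* r x [] (G [])
    ; ⟨0∣0⟩≈1 = eval-return [] (G [])
    ; a∣0⟩≈0  = λ _ _ _ → refl
    ; ⟨0∣a†≈0 = λ i k x → trans (eval-bind (normal x) _ (G []))
        (eval-0 (normal x) λ w → eval-return ((i , k) ∷ w) (G []))
    }

  monomial : Word → 𝐀
  monomial []            = const 1#
  monomial ((i , k) ∷ w) = a† i k *ᴬ monomial w

  -- For a generator this is an expansion of G along a first letter: of the row word for a creator
  -- x, of the column word for an annihilator x. Products reverse on both sides.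
  act-adjoint : ∀ x v w → eval (act (x †) w) (G v) ≈ eval (act x v) (λ u → G u w)
  act-adjoint (const r) v w = refl
  act-adjoint (a j l)   v w = begin
    eval [ (1# , (j , l) ∷ w) ] (G v)
      ≈⟨ eval-return ((j , l) ∷ w) (G v) ⟩
    G v ((j , l) ∷ w)
      ≈⟨ gram-expandʳ letterForm v (j , l) w ⟩
    eval (picks v) (λ (z , u) → letterForm z (j , l) * G u w)
      ≈⟨ eval-cong (picks v) (λ (z , u) → *-congʳ (letterForm-sym z (j , l))) ⟩
    eval (picks v) (λ (z , u) → letterForm (j , l) z * G u w)
      ≈⟨ eval-annihilate (j , l) v _ ⟨
    eval (annihilate (j , l) v) (λ u → G u w) ∎
  act-adjoint (a† i k)  v w = trans (eval-annihilate (i , k) w (G v))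
    (sym (eval-return ((i , k) ∷ v) (λ u → G u w)))
  act-adjoint (x +ᴬ y)  v w = trans (eval-++ (act (x †) w) _ (G v))
    (trans (+-cong (act-adjoint x v w) (act-adjoint y v w))
           (sym (eval-++ (act x v) _ _)))
  act-adjoint (x *ᴬ y)  v w = begin
    eval (bind (act (x †) w) (act (y †))) (G v)
      ≈⟨ eval-bind (act (x †) w) _ (G v) ⟩
    eval (act (x †) w) (λ w′ → eval (act (y †) w′) (G v))
      ≈⟨ eval-cong (act (x †) w) (act-adjoint y v) ⟩
    eval (act (x †) w) (λ w′ → eval (act y v) (λ u → G u w′))
      ≈⟨ eval-swap (act (x †) w) (act y v) _ ⟩
    eval (act y v) (λ u → eval (act (x †) w) (G u))
      ≈⟨ eval-cong (act y v) (λ u → act-adjoint x u w) ⟩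
    eval (act y v) (λ u → eval (act x u) (λ u′ → G u′ w))
      ≈⟨ eval-bind (act y v) (act x) _ ⟨
    eval (bind (act y v) (act x)) (λ u → G u w) ∎

  module _ (E : VacuumExpectation) where
    open VacuumExpectation E renaming (cong to E-cong)

    *constᴬ : ∀ x → x *ᴬ const 1# ≈ᴬ x
    *constᴬ x = transᴬ (symᴬ (const-comm 1# x)) (*-identityˡᴬ x)

    E-const : ∀ z r x → ⟨0∣ z *ᴬ (const r *ᴬ x) ∣0⟩ ≈ r * ⟨0∣ z *ᴬ x ∣0⟩
    E-const z r x = trans
      (E-cong (transᴬ (symᴬ (*-assocᴬ z (const r) x))
        (transᴬ (*-congᴬ (symᴬ (const-comm r z)) reflᴬ) (*-assocᴬ (const r) z x))))
      (*-homo r (z *ᴬ x))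

    E-+ : ∀ z x y → ⟨0∣ z *ᴬ (x +ᴬ y) ∣0⟩ ≈ ⟨0∣ z *ᴬ x ∣0⟩ + ⟨0∣ z *ᴬ y ∣0⟩
    E-+ z x y = trans (E-cong (distribˡᴬ z x y)) (+-homo _ _)

    -- The left factor z is arbitrary so that it can absorb the creators that the annihilator has
    -- already passed.
    E-annihilate : ∀ j l w z → ⟨0∣ z *ᴬ (a j l *ᴬ monomial w) ∣0⟩ ≈
                   eval (annihilate (j , l) w) (λ u → ⟨0∣ z *ᴬ monomial u ∣0⟩)
    E-annihilate j l []            z = trans
      (E-cong (*-congᴬ reflᴬ (*constᴬ (a j l)))) (a∣0⟩≈0 z j l)
    E-annihilate j l ((i , k) ∷ w) z = begin
      ⟨0∣ z *ᴬ (a j l *ᴬ (a† i k *ᴬ M)) ∣0⟩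
        ≈⟨ E-cong (*-congᴬ reflᴬ (transᴬ (symᴬ (*-assocᴬ _ _ _))
             (transᴬ (*-congᴬ (commutation i k j l) reflᴬ) (distribʳᴬ _ _ _)))) ⟩
      ⟨0∣ z *ᴬ ((const q *ᴬ (a† i k *ᴬ a j l)) *ᴬ M +ᴬ const B *ᴬ M) ∣0⟩
        ≈⟨ E-+ z _ _ ⟩
      ⟨0∣ z *ᴬ ((const q *ᴬ (a† i k *ᴬ a j l)) *ᴬ M) ∣0⟩ + ⟨0∣ z *ᴬ (const B *ᴬ M) ∣0⟩
        ≈⟨ +-cong
             (trans (E-cong (*-congᴬ reflᴬ (*-assocᴬ _ _ _))) (E-const z q _))
             (E-const z B M) ⟩
      q * ⟨0∣ z *ᴬ ((a† i k *ᴬ a j l) *ᴬ M) ∣0⟩ + B * ⟨0∣ z *ᴬ M ∣0⟩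
        ≈⟨ +-congʳ (*-congˡ (trans
             (E-cong (transᴬ (*-congᴬ reflᴬ (*-assocᴬ _ _ _)) (symᴬ (*-assocᴬ _ _ _))))
             (trans (E-annihilate j l w (z *ᴬ a† i k))
                    (eval-cong (annihilate (j , l) w) λ u → E-cong (*-assocᴬ _ _ _))))) ⟩
      q * eval (annihilate (j , l) w) (λ u → ⟨0∣ z *ᴬ monomial ((i , k) ∷ u) ∣0⟩) + B * ⟨0∣ z *ᴬ M ∣0⟩
        ≈⟨ +-comm _ _ ⟩
      B * ⟨0∣ z *ᴬ M ∣0⟩ + q * eval (annihilate (j , l) w) (λ u → ⟨0∣ z *ᴬ monomial ((i , k) ∷ u) ∣0⟩)
        ≈⟨ +-congˡ (eval-scale q _ (annihilate (j , l) w) _) ⟨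
      eval (annihilate (j , l) ((i , k) ∷ w)) (λ u → ⟨0∣ z *ᴬ monomial u ∣0⟩) ∎
      where
      M = monomial w
      B = (q ^ β m k l) * δ ℝ i j

    E-act : ∀ x w z → ⟨0∣ z *ᴬ (x *ᴬ monomial w) ∣0⟩ ≈
            eval (act x w) (λ u → ⟨0∣ z *ᴬ monomial u ∣0⟩)
    E-act (const r) w z = trans (E-const z r (monomial w))
      (sym (eval-single r w (λ u → ⟨0∣ z *ᴬ monomial u ∣0⟩)))
    E-act (a j l)   w z = E-annihilate j l w z
    E-act (a† i k)  w z = sym (eval-return ((i , k) ∷ w) (λ u → ⟨0∣ z *ᴬ monomial u ∣0⟩))
    E-act (x +ᴬ y)  w z = trans (E-cong (*-congᴬ reflᴬ (distribʳᴬ _ x y)))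
      (trans (E-+ z _ _) (trans (+-cong (E-act x w z) (E-act y w z)) (sym (eval-++ (act x w) _ _))))
    E-act (x *ᴬ y)  w z = begin
      ⟨0∣ z *ᴬ ((x *ᴬ y) *ᴬ monomial w) ∣0⟩
        ≈⟨ E-cong (transᴬ (*-congᴬ reflᴬ (*-assocᴬ _ _ _)) (symᴬ (*-assocᴬ _ _ _))) ⟩
      ⟨0∣ (z *ᴬ x) *ᴬ (y *ᴬ monomial w) ∣0⟩
        ≈⟨ E-act y w (z *ᴬ x) ⟩
      eval (act y w) (λ u → ⟨0∣ (z *ᴬ x) *ᴬ monomial u ∣0⟩)
        ≈⟨ eval-cong (act y w) (λ u → trans (E-cong (*-assocᴬ _ _ _)) (E-act x u z)) ⟩
      eval (act y w) (λ u → eval (act x u) (λ u′ → ⟨0∣ z *ᴬ monomial u′ ∣0⟩))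
        ≈⟨ eval-bind (act y w) (act x) _ ⟨
      eval (bind (act y w) (act x)) (λ u → ⟨0∣ z *ᴬ monomial u ∣0⟩) ∎

    E-monomial : ∀ w → ⟨0∣ const 1# *ᴬ monomial w ∣0⟩ ≈ G [] w
    E-monomial []            = trans (E-cong (*constᴬ _)) ⟨0∣0⟩≈1
    E-monomial ((i , k) ∷ w) = trans (E-cong (*-identityˡᴬ _)) (⟨0∣a†≈0 i k _)

    -- Normal ordering rewrites x into creators only, and on a word of creators the axioms leave no
    -- choice of value.
    E-unique : ∀ x → ⟨0∣ x ∣0⟩ ≈ eval (normal x) (G [])
    E-unique x = begin
      ⟨0∣ x ∣0⟩
        ≈⟨ E-cong (transᴬ (*-identityˡᴬ _) (*constᴬ x)) ⟨
      ⟨0∣ const 1# *ᴬ (x *ᴬ const 1#) ∣0⟩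
        ≈⟨ E-act x [] (const 1#) ⟩
      eval (normal x) (λ u → ⟨0∣ const 1# *ᴬ monomial u ∣0⟩)
        ≈⟨ eval-cong (normal x) E-monomial ⟩
      eval (normal x) (G []) ∎

    E-gram : ∀ x y → ⟨0∣ x † *ᴬ y ∣0⟩ ≈ ⟪ G ⟫ (normal x) (normal y)
    E-gram x y = begin
      ⟨0∣ x † *ᴬ y ∣0⟩
        ≈⟨ E-unique (x † *ᴬ y) ⟩
      eval (bind (normal y) (act (x †))) (G [])
        ≈⟨ eval-bind (normal y) _ _ ⟩
      eval (normal y) (λ w → eval (act (x †) w) (G []))
        ≈⟨ eval-cong (normal y) (act-adjoint x []) ⟩
      eval (normal y) (λ w → eval (normal x) (λ u → G u w))
        ≈⟨ eval-swap (normal y) (normal x) _ ⟩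
      ⟪ G ⟫ (normal x) (normal y) ∎

  ⟪G⟫-sym : ∀ d e → ⟪ G ⟫ d e ≈ ⟪ G ⟫ e d
  ⟪G⟫-sym d e = trans (eval-swap d e G)
    (eval-cong e λ w → eval-cong d λ v → gram-sym letterForm letterForm-sym v w)

-- Linear independence of the states in V.

module FockSpace {c ℓ₁ ℓ₂ v ℓv} (ℝ : RealNumbers c ℓ₁ ℓ₂) (m : ℕ) (1≤m : 1 ℕ.≤ m)
                 (q : RealNumbers.Carrier ℝ) (adm : Admissible ℝ m q)
                 (V : Module (RealNumbers.commutativeRing ℝ) v ℓv)
                 (ρ : QuonAlgebra.FockRepresentation ℝ m q V) where
  open RealNumbers ℝ hiding (zero)
  open OrderedField ℝ
  open Combinations ℝ
  open QGram ℝ q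
  open LetterForm ℝ m q
  open QuonAlgebra ℝ m q
  open NormalOrdering ℝ m q
  open Positivity ℝ V
  open GramPositivity ℝ q V
  open Module V
  open FockRepresentation ρ
  open Evaluation V using () renaming
    ( eval to evalⱽ; eval-cong to evalⱽ-cong; eval-map to evalⱽ-map; eval-0 to evalⱽ-0
    ; eval-scale to evalⱽ-scale; eval-return to evalⱽ-return; eval-bind to evalⱽ-bind
    ; eval-++ to evalⱽ-++; eval-split to evalⱽ-split
    ; eval-cong-All to evalⱽ-cong-All )
  private
    module R = ≈-Reasoning setoid
    module M = ≈-Reasoning ≈ᴹ-setoid

  record Linear (f : Carrierᴹ → Carrierᴹ) : Set (c ⊔ v ⊔ ℓv) where
    field
      cong   : ∀ {u w} → u ≈ᴹ w → f u ≈ᴹ f w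
      +-homo : ∀ u w → f (u +ᴹ w) ≈ᴹ f u +ᴹ f w
      *-homo : ∀ r u → f (r *ₗ u) ≈ᴹ r *ₗ f u

    0-homo : f 0ᴹ ≈ᴹ 0ᴹ
    0-homo = ≈ᴹ-trans (cong (≈ᴹ-sym (*ₗ-zeroˡ 0ᴹ))) (≈ᴹ-trans (*-homo 0# 0ᴹ) (*ₗ-zeroˡ _))

    evalⱽ-homo : ∀ {X : Set} (d : LC X) φ → f (evalⱽ d φ) ≈ᴹ evalⱽ d (f ∘ φ)
    evalⱽ-homo = eval-linear V V 0-homo +-homo *-homo

  op-linear : ∀ i k → Linear (op i k)
  op-linear i k = record
    { cong = ⟦⟧-cong ; +-homo = +ᴹ-homo ; *-homo = *ₗ-homo }
    where open IsModuleHomomorphism (linear i k)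

  op†-linear : ∀ i k → Linear (op† i k)
  op†-linear i k = record
    { cong = ⟦⟧-cong ; +-homo = +ᴹ-homo ; *-homo = *ₗ-homo }
    where open IsModuleHomomorphism (linear† i k)

  ∘-linear : ∀ {f g} → Linear f → Linear g → Linear (f ∘ g)
  ∘-linear F G = record
    { cong   = F.cong ∘ G.cong
    ; +-homo = λ u w → ≈ᴹ-trans (F.cong (G.+-homo u w)) (F.+-homo _ _)
    ; *-homo = λ r u → ≈ᴹ-trans (F.cong (G.*-homo r u)) (F.*-homo r _)
    }
    where
    module F = Linear F
    module G = Linear G

  ·-linear : ∀ x → Linear (x ·_)
  ·-linear (const r) = record
    { cong   = *ₗ-cong refl
    ; +-homo = *ₗ-distribˡ r
    ; *-homo = λ s u → ≈ᴹ-trans (≈ᴹ-sym (*ₗ-assoc r s u))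
                 (≈ᴹ-trans (*ₗ-cong (*-comm r s) ≈ᴹ-refl) (*ₗ-assoc s r u))
    }
  ·-linear (a i k)   = op-linear i k
  ·-linear (a† i k)  = op†-linear i k
  ·-linear (x +ᴬ y)  = record
    { cong   = λ p → +ᴹ-cong (X.cong p) (Y.cong p)
    ; +-homo = λ u w → ≈ᴹ-trans (+ᴹ-cong (X.+-homo u w) (Y.+-homo u w)) (interchange _ _ _ _)
    ; *-homo = λ r u → ≈ᴹ-trans (+ᴹ-cong (X.*-homo r u) (Y.*-homo r u)) (≈ᴹ-sym (*ₗ-distribˡ r _ _))
    }
    where
    module X = Linear (·-linear x)
    module Y = Linear (·-linear y)
    open CommutativeSemigroupProperties
      (CommutativeMonoid.commutativeSemigroup +ᴹ-commutativeMonoid) using (interchange)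
  ·-linear (x *ᴬ y)  = ∘-linear (·-linear x) (·-linear y)

  state : Word → Carrierᴹ
  state []            = ∣0⟩
  state ((i , k) ∷ w) = op† i k (state w)

  op-state : ∀ j l w → op j l (state w) ≈ᴹ evalⱽ (annihilate (j , l) w) state
  op-state j l []            = op∣0⟩≈0 j l
  op-state j l ((i , k) ∷ w) = M.begin
    op j l (op† i k (state w))
      M.≈⟨ relation i k j l (state w) ⟩
    q *ₗ op† i k (op j l (state w)) +ᴹ B *ₗ state w
      M.≈⟨ +ᴹ-cong (*ₗ-cong refl (≈ᴹ-trans
             (Linear.cong (op†-linear i k) (op-state j l w))
             (Linear.evalⱽ-homo (op†-linear i k) (annihilate (j , l) w) state))) ≈ᴹ-refl ⟩
    q *ₗ evalⱽ (annihilate (j , l) w) (op† i k ∘ state) +ᴹ B *ₗ state w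
      M.≈⟨ +ᴹ-comm _ _ ⟩
    B *ₗ state w +ᴹ q *ₗ evalⱽ (annihilate (j , l) w) (op† i k ∘ state)
      M.≈⟨ +ᴹ-cong ≈ᴹ-refl (evalⱽ-scale q _ (annihilate (j , l) w) state) ⟨
    evalⱽ (annihilate (j , l) ((i , k) ∷ w)) state M.∎
    where B = (q ^ β m k l) * δ ℝ i j

  ·-state : ∀ x w → x · state w ≈ᴹ evalⱽ (act x w) state
  ·-state (const r) w = ≈ᴹ-sym (+ᴹ-identityʳ _)
  ·-state (a j l)   w = op-state j l w
  ·-state (a† i k)  w = ≈ᴹ-sym (evalⱽ-return ((i , k) ∷ w) state)
  ·-state (x +ᴬ y)  w = ≈ᴹ-trans (+ᴹ-cong (·-state x w) (·-state y w))
                          (≈ᴹ-sym (evalⱽ-++ (act x w) _ state))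
  ·-state (x *ᴬ y)  w = M.begin
    x · y · state w
      M.≈⟨ Linear.cong (·-linear x) (·-state y w) ⟩
    x · evalⱽ (act y w) state
      M.≈⟨ Linear.evalⱽ-homo (·-linear x) (act y w) state ⟩
    evalⱽ (act y w) (λ u → x · state u)
      M.≈⟨ evalⱽ-cong (act y w) (·-state x) ⟩
    evalⱽ (act y w) (λ u → evalⱽ (act x u) state)
      M.≈⟨ evalⱽ-bind (act y w) (act x) state ⟨
    evalⱽ (bind (act y w) (act x)) state M.∎

  lower : Word → Carrierᴹ → Carrierᴹ
  lower []            u = u
  lower ((j , l) ∷ w) u = lower w (op j l u)

  lower-linear : ∀ w → Linear (lower w)
  lower-linear []            = record
    { cong = id ; +-homo = λ _ _ → ≈ᴹ-refl ; *-homo = λ _ _ → ≈ᴹ-refl }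
  lower-linear ((j , l) ∷ w) = ∘-linear (lower-linear w) (op-linear j l)

  -- Each annihilator shortens the word by one, so a word no longer than v ends at a multiple of the
  -- vacuum. If it is strictly shorter, both sides vanish.
  lower-state : ∀ v w → length w ℕ.≤ length v → lower v (state w) ≈ᴹ G v w *ₗ ∣0⟩
  lower-state []            []      _   = ≈ᴹ-sym (*ₗ-identityˡ ∣0⟩)
  lower-state ((j , l) ∷ v) w       |w|≤1+|v| = M.begin
    lower v (op j l (state w))
      M.≈⟨ Linear.cong (lower-linear v) (op-state j l w) ⟩
    lower v (evalⱽ (annihilate (j , l) w) state)
      M.≈⟨ Linear.evalⱽ-homo (lower-linear v) (annihilate (j , l) w) state ⟩
    evalⱽ (annihilate (j , l) w) (lower v ∘ state)
      M.≈⟨ evalⱽ-cong-All (annihilate (j , l) w) (All.map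
             (λ {(_ , u)} |w|≡1+|u| → lower-state v u
               (ℕₚ.≤-pred (≡.subst (ℕ._≤ suc (length v)) |w|≡1+|u| |w|≤1+|v|)))
             (annihilate-length (j , l) w)) ⟩
    evalⱽ (annihilate (j , l) w) (λ u → G v u *ₗ ∣0⟩)
      M.≈⟨ eval-*-vector V (annihilate (j , l) w) (G v) ∣0⟩ ⟩
    eval (annihilate (j , l) w) (G v) *ₗ ∣0⟩
      M.≈⟨ *ₗ-cong (eval-annihilate (j , l) w (G v)) ≈ᴹ-refl ⟩
    G ((j , l) ∷ v) w *ₗ ∣0⟩ M.∎

  -- A scalar apart from 0 could be inverted, which would make the vacuum zero; tightness then gives
  -- equality.
  *ₗ∣0⟩≈0 : ∀ {r} → r *ₗ ∣0⟩ ≈ᴹ 0ᴹ → r ≈ 0#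
  *ₗ∣0⟩≈0 {r} r∣0⟩≈0 = proj₁ (tight r 0#) λ r#0 →
    let s , s*r≈1 , _ = #⇒invertible r#0 in
    ∣0⟩≉0 (M.begin
      ∣0⟩                   M.≈⟨ *ₗ-identityˡ ∣0⟩ ⟨
      1# *ₗ ∣0⟩             M.≈⟨ *ₗ-cong s*r≈1 ≈ᴹ-refl ⟨
      (s * (r - 0#)) *ₗ ∣0⟩ M.≈⟨ *ₗ-cong (*-congˡ (x-0≈x r)) ≈ᴹ-refl ⟩
      (s * r) *ₗ ∣0⟩        M.≈⟨ *ₗ-assoc s r ∣0⟩ ⟩
      s *ₗ r *ₗ ∣0⟩         M.≈⟨ *ₗ-cong refl r∣0⟩≈0 ⟩
      s *ₗ 0ᴹ               M.≈⟨ *ₗ-zeroʳ s ⟩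
      0ᴹ                    M.∎)

  private
    side-tp = side-tensorPositive V 1≤m adm
    letter-tp = letterForm-tensorPositive V 1≤m adm

    word : Σ ℕ (Vec Letter) → Word
    word (_ , w) = toList w

  -- The part of top degree N is orthogonal to itself, as is seen by lowering
  -- with each word of length N; hence it vanishes and N can be decreased.
  graded-independent : ∀ N (d : LC (Σ ℕ (Vec Letter))) → Below N d →
    evalⱽ d (state ∘ word) ≈ᴹ 0ᴹ → ∀ φ → evalⱽ d φ ≈ᴹ 0ᴹ
  graded-independent zero    [] [] _ φ = ≈ᴹ-refl
  graded-independent (suc N) d  p  d≈0 φ = ≈ᴹ-trans (splitⱽ φ)
    (≈ᴹ-trans (+ᴹ-cong (top≈0 _) (graded-independent N rest rest-below rest≈0 φ)) (+ᴹ-identityˡ 0ᴹ))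
    where
    top  = lefts (component N) d
    rest = rights (component N) d
    rest-below = rights-below N d p
    splitⱽ = evalⱽ-split (component N) (N ,_) id (component-inv N) d

    G-d≈0 : ∀ (w : Vec Letter N) → eval d (G (toList w) ∘ word) ≈ 0#
    G-d≈0 w = *ₗ∣0⟩≈0 (M.begin
      eval d (G (toList w) ∘ word) *ₗ ∣0⟩
        M.≈⟨ eval-*-vector V d (G (toList w) ∘ word) ∣0⟩ ⟨
      evalⱽ d (λ u → G (toList w) (word u) *ₗ ∣0⟩)
        M.≈⟨ evalⱽ-cong-All d (All.map (λ {(_ , n , u)} n<1+N → ≈ᴹ-sym
               (lower-state (toList w) (toList u) (≡.subst₂ ℕ._≤_
                 (≡.sym (Vecₚ.length-toList u)) (≡.sym (Vecₚ.length-toList w))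
                 (ℕₚ.≤-pred n<1+N)))) p) ⟩
      evalⱽ d (lower (toList w) ∘ state ∘ word)
        M.≈⟨ Linear.evalⱽ-homo (lower-linear (toList w)) d (state ∘ word) ⟨
      lower (toList w) (evalⱽ d (state ∘ word))
        M.≈⟨ Linear.cong (lower-linear (toList w)) d≈0 ⟩
      lower (toList w) 0ᴹ
        M.≈⟨ Linear.0-homo (lower-linear (toList w)) ⟩
      0ᴹ M.∎)

    G-rest≈0 : ∀ (w : Vec Letter N) → eval rest (G (toList w) ∘ word) ≈ 0#
    G-rest≈0 w = eval-0-All rest (All.map
      (λ {(_ , n , u)} n<N → gram≈0 letterForm (toList w) (toList u) λ eq →
        ℕₚ.<⇒≢ n<N (≡.trans (≡.sym (Vecₚ.length-toList u))
          (≡.trans (≡.sym eq) (Vecₚ.length-toList w))))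
      rest-below)

    G-top≈0 : ∀ (w : Vec Letter N) → eval top (vecGram letterForm w) ≈ 0#
    G-top≈0 w = R.begin
      eval top (vecGram letterForm w)
        R.≈⟨ +-identityʳ _ ⟨
      eval top (vecGram letterForm w) + 0#
        R.≈⟨ +-congˡ (G-rest≈0 w) ⟨
      eval top (vecGram letterForm w) + eval rest (G (toList w) ∘ word)
        R.≈⟨ eval-split (component N) (N ,_) id (component-inv N) d (G (toList w) ∘ word) ⟨
      eval d (G (toList w) ∘ word)
        R.≈⟨ G-d≈0 w ⟩
      0# R.∎

    top≈0 : ∀ φ → evalⱽ top φ ≈ᴹ 0ᴹ
    top≈0 = definite (vecGram-pd side-tp N letter-tp top) (eval-0 top G-top≈0)

    rest≈0 : evalⱽ rest (state ∘ word) ≈ᴹ 0ᴹ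
    rest≈0 = ≈ᴹ-trans (≈ᴹ-sym (≈ᴹ-trans (splitⱽ (state ∘ word))
      (≈ᴹ-trans (+ᴹ-cong (top≈0 _) ≈ᴹ-refl) (+ᴹ-identityˡ _)))) d≈0

  independent : ∀ (d : LC Word) → evalⱽ d state ≈ᴹ 0ᴹ → ∀ φ → evalⱽ d φ ≈ᴹ 0ᴹ
  independent d d≈0 φ = ≈ᴹ-trans (≈ᴹ-sym (via-vec φ))
    (graded-independent _ d′ (proj₂ (bound d′)) (≈ᴹ-trans (via-vec state) d≈0) (φ ∘ word))
    where
    d′ = scale 1# (λ w → length w , fromList w) d
    via-vec : ∀ φ → evalⱽ d′ (φ ∘ word) ≈ᴹ evalⱽ d φ
    via-vec φ = ≈ᴹ-trans (evalⱽ-map _ d (φ ∘ word))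
      (evalⱽ-cong d λ w → ≈ᴹ-reflexive (≡.cong φ (Vecₚ.toList∘fromList w)))

  -- Every scalar function of the coordinates is well defined on vectors of V, so in particular is
  -- the form.
  eval-determined : ∀ (d e : LC Word) → evalⱽ d state ≈ᴹ evalⱽ e state →
                    ∀ φ → eval d φ ≈ eval e φ
  eval-determined d e d≈e φ = R.begin
    eval d φ                             R.≈⟨ +-identityʳ _ ⟨
    eval d φ + 0#                        R.≈⟨ +-congˡ (-‿inverseˡ _) ⟨
    eval d φ + (- eval e φ + eval e φ)   R.≈⟨ +-assoc _ _ _ ⟨
    (eval d φ - eval e φ) + eval e φ     R.≈⟨ +-congʳ difference≈0 ⟩
    0# + eval e φ                        R.≈⟨ +-identityˡ _ ⟩
    eval e φ                             R.∎
    where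
    open RingProperties ring using (-1*x≈-x)
    diff = d ++ scale (- 1#) id e

    state-diff≈0 : evalⱽ diff state ≈ᴹ 0ᴹ
    state-diff≈0 = M.begin
      evalⱽ diff state
        M.≈⟨ ≈ᴹ-trans (evalⱽ-++ d _ state) (+ᴹ-cong d≈e (evalⱽ-scale (- 1#) id e state)) ⟩
      evalⱽ e state +ᴹ (- 1#) *ₗ evalⱽ e state
        M.≈⟨ +ᴹ-cong (*ₗ-identityˡ _) ≈ᴹ-refl ⟨
      1# *ₗ evalⱽ e state +ᴹ (- 1#) *ₗ evalⱽ e state
        M.≈⟨ *ₗ-distribʳ _ 1# (- 1#) ⟨
      (1# - 1#) *ₗ evalⱽ e state
        M.≈⟨ *ₗ-cong (-‿inverseʳ 1#) ≈ᴹ-refl ⟩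
      0# *ₗ evalⱽ e state
        M.≈⟨ *ₗ-zeroˡ _ ⟩
      0ᴹ M.∎

    difference≈0 : eval d φ - eval e φ ≈ 0#
    difference≈0 = R.begin
      eval d φ - eval e φ           R.≈⟨ +-congˡ (-1*x≈-x _) ⟨
      eval d φ + - 1# * eval e φ    R.≈⟨ +-congˡ (eval-scale (- 1#) id e φ) ⟨
      eval d φ + eval (scale (- 1#) id e) φ  R.≈⟨ eval-++ d _ φ ⟨
      -- `independent` speaks of values in V, so the scalar function φ is tested there as multiples
      -- of the vacuum.
      eval diff φ                   R.≈⟨ *ₗ∣0⟩≈0 (≈ᴹ-trans (≈ᴹ-sym (eval-*-vector V diff φ ∣0⟩))
                                           (independent diff state-diff≈0 _)) ⟩
      0#                            R.∎

  -- The inner product on H.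

  module _ (E : VacuumExpectation) where
    private
      open Module H using () renaming (_+ᴹ_ to _+ᴴ_; _*ₗ_ to _*ᴴ_)

      ⟨_,_⟩ = form E

      coords : Hᶜ → LC Word
      coords (_ , x , _) = normal x

      vector≈ : ∀ u → proj₁ u ≈ᴹ evalⱽ (coords u) state
      vector≈ (_ , x , p) = ≈ᴹ-trans p (·-state x [])

      form≈ : ∀ u w → ⟨ u , w ⟩ ≈ ⟪ G ⟫ (coords u) (coords w)
      form≈ (_ , x , _) (_ , y , _) = E-gram E x y

      form-sym : ∀ u w → ⟨ u , w ⟩ ≈ ⟨ w , u ⟩
      form-sym u w = trans (form≈ u w) (trans (⟪G⟫-sym (coords u) (coords w)) (sym (form≈ w u)))

      -- Two elements of 𝐀 that produce the same vector have normal forms with the same image under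
      -- `state`; independence of the states makes the form agree on them.
      form-congˡ : ∀ {u u′} w → proj₁ u ≈ᴹ proj₁ u′ → ⟨ u , w ⟩ ≈ ⟨ u′ , w ⟩
      form-congˡ {u} {u′} w u≈u′ = trans (form≈ u w) (trans
        (eval-determined (coords u) (coords u′)
          (≈ᴹ-trans (≈ᴹ-sym (vector≈ u)) (≈ᴹ-trans u≈u′ (vector≈ u′))) _)
        (sym (form≈ u′ w)))

      form-+ˡ : ∀ u u′ w → ⟨ u +ᴴ u′ , w ⟩ ≈ ⟨ u , w ⟩ + ⟨ u′ , w ⟩
      form-+ˡ u u′ w = trans (form≈ (u +ᴴ u′) w) (trans
        (eval-++ (coords u) (coords u′) _) (sym (+-cong (form≈ u w) (form≈ u′ w))))

      form-*ˡ : ∀ r u w → ⟨ r *ᴴ u , w ⟩ ≈ r * ⟨ u , w ⟩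
      form-*ˡ r u@(_ , x , _) w = trans (form≈ (r *ᴴ u) w) (trans
        (eval-const* r x [] _) (sym (*-congˡ (form≈ u w))))

    form-isInnerProduct : IsInnerProduct ℝ H (form E)
    form-isInnerProduct = record
      { cong      = λ {u} {u′} {w} {w′} u≈u′ w≈w′ → trans (form-congˡ {u} {u′} w u≈u′)
          (trans (form-sym u′ w) (trans (form-congˡ {w} {w′} u′ w≈w′) (form-sym w′ u′)))
      ; +-linearˡ = form-+ˡ
      ; *-linearˡ = form-*ˡ
      ; +-linearʳ = λ u w w′ → trans (form-sym u (w +ᴴ w′))
          (trans (form-+ˡ w w′ u) (+-cong (form-sym w u) (form-sym w′ u)))
      ; *-linearʳ = λ r u w → trans (form-sym u (r *ᴴ w))
          (trans (form-*ˡ r w u) (*-congˡ (form-sym w u)))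
      ; symmetric = form-sym
      ; nonNeg    = λ u → ≼-congʳ (sym (form≈ u u)) (nonneg (G-pd (coords u)))
      -- Definiteness of G is tested with `state`, which turns the coordinates back into the vector.
      ; definite  = λ u ⟨u,u⟩≈0 → ≈ᴹ-trans (vector≈ u)
          (definite (G-pd (coords u)) (trans (sym (form≈ u u)) ⟨u,u⟩≈0) state)
      }
      where G-pd = gram-pd side-tp letter-tp

open import Data.Nat.Base using (_≤_)

theorem1p1 : ∀ {c ℓ₁ ℓ₂ v ℓv} (ℝ : RealNumbers c ℓ₁ ℓ₂) (m : ℕ) → 1 ≤ m →
    (q : RealNumbers.Carrier ℝ) → Admissible ℝ m q →
    let open QuonAlgebra ℝ m q in
    (V : Module (RealNumbers.commutativeRing ℝ) v ℓv) (ρ : FockRepresentation V) →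
    VacuumExpectation ×
    ((E : VacuumExpectation) →
    IsInnerProduct ℝ (FockRepresentation.H ρ) (FockRepresentation.form ρ E))
theorem1p1 ℝ m 1≤m q adm V ρ =
  NormalOrdering.vacuumExpectation ℝ m q ,
  FockSpace.form-isInnerProduct ℝ m 1≤m q adm V ρ
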